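{- Any streaming algorithm that solves \textsc{sink-find-t} in $p$ passes (with error probability at most $1/3$) must use $\Omega(n^{1/p}/p^2)$ space.
   Context: Input: an $n$-vertex tournament presented as a stream of edges in arbitrary (adversarial) order. \textsc{sink-find-t}: under the promise that the input is an acyclic tournament, output a sink (vertex with no outgoing edges). -}

module Defs where

open import Data.Nat using (ℕ; zero; suc; _+_; _*_; _^_; _≤_; _<_)
open import Data.Fin using (Fin; toℕ)
open import Data.Product using (_×_; _,_; Σ)
open import Data.List using (List; []; _∷_; foldl; filter; length; allFin; concatMap)
open import Data.List.Relation.Binary.Permutation.Propositional using (_↭_)
open import Relation.Binary.PropositionalEquality using (_≡_)
open import Relation.Nullary using (¬_; Dec; ¬?)
open import Function.Bundles using (_↔_)
open import Function using (_∘_)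
open import Data.Fin using (_≟_)

Edge : ℕ → Set
Edge n = Fin n × Fin n

-- A stream of edges. A stream "presents" a tournament T if every edge
-- occurs exactly once: the stream is a permutation of some list which
-- contains exactly the edges of T, each once.
-- We encode acyclic tournaments concretely by a ranking (a bijection
-- rank : Fin n ↔ Fin n); u → v iff rank u < rank v.  Every acyclic
-- tournament on Fin n arises this way (its topological order).
module _ {n : ℕ} (rank : Fin n ↔ Fin n) where
  open Function.Bundles.Inverse rank renaming (to to rk)

  _⇒ᵣ_ : Fin n → Fin n → Set
  u ⇒ᵣ v = toℕ (rk u) < toℕ (rk v)

  IsSink : Fin n → Set
  IsSink u = ∀ v → ¬ (u ⇒ᵣ v)

edgeList : ∀ {n} → (Fin n ↔ Fin n) → List (Edge n)
edgeList {n} rank =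
  concatMap (λ u → Data.List.map (u ,_) (filter (λ v → toℕ (rk u) Data.Nat.<? toℕ (rk v)) (allFin n))) (allFin n)
  where
    open Function.Bundles.Inverse rank renaming (to to rk)
    import Data.Nat

ValidStream : ∀ {n} → (Fin n ↔ Fin n) → List (Edge n) → Set
ValidStream rank σ = σ ↭ edgeList rank

-- A randomized p-pass streaming algorithm on n-vertex inputs using
-- s bits of memory: memory states are Fin (2 ^ s).  Randomness is a
-- uniformly random seed from Fin R (R ≥ 1) which is not charged to the
-- space (public / free random coins; this only strengthens a lower bound).
record StreamAlg (n p s : ℕ) : Set where
  field
    R      : ℕ
    R≥1    : 1 ≤ R
    init   : Fin R → Fin (2 ^ s)
    step   : Fin R → Fin p → Fin (2 ^ s) → Edge n → Fin (2 ^ s)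
    output : Fin R → Fin (2 ^ s) → Fin n

open StreamAlg

runPasses : ∀ {n p s} (A : StreamAlg n p s) (r : Fin (R A)) →
            List (Edge n) → (k : ℕ) → k ≤ p → Fin (2 ^ s) → Fin (2 ^ s)
runPasses A r σ zero _ m = m
runPasses {p = p} A r σ (suc k) sk≤p m =
  foldl (step A r (Data.Fin.fromℕ< sk≤p)) (runPasses A r σ k (Data.Nat.Properties.<⇒≤ sk≤p) m) σ
  where import Data.Nat.Properties

run : ∀ {n p s} (A : StreamAlg n p s) → Fin (R A) → List (Edge n) → Fin n
run {p = p} A r σ = output A r (runPasses A r σ p Data.Nat.Properties.≤-refl (init A r))
  where import Data.Nat.Properties

isSink? : ∀ {n} (rank : Fin n ↔ Fin n) (u : Fin n) → Dec (IsSink rank u)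
isSink? rank u = Data.Fin.Properties.all? (λ v → ¬? (_ Data.Nat.<? _))
  where
    import Data.Fin.Properties
    import Data.Nat

goodSeeds : ∀ {n p s} (A : StreamAlg n p s) → (Fin n ↔ Fin n) → List (Edge n) → ℕ
goodSeeds A rank σ = length (filter (λ r → isSink? rank (run A r σ)) (allFin (R A)))

Solves : ∀ {n p s} → StreamAlg n p s → Set
Solves {n} A = ∀ (rank : Fin n ↔ Fin n) (σ : List (Edge n)) → ValidStream rank σ →
               2 * R A ≤ 3 * goodSeeds A rank σ

module Submission where

open import Defs
open import Data.Bool as Bool using (Bool; true; false; T; _∧_; not)
open import Data.Empty using (⊥; ⊥-elim)
open import Data.Fin as Fin using
  (Fin; zero; suc; toℕ; fromℕ; fromℕ<; combine; remQuot; splitAt; finToFun; funToFin; _↑ˡ_; _↑ʳ_)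
open import Data.Fin.Permutation using (Permutation′; _⟨$⟩ʳ_; transpose)
import Data.Fin.Properties as Fin
open import Data.List using
  (List; []; _∷_; _++_; map; length; allFin; filter; filterᵇ; foldl; concatMap; cartesianProduct; cartesianProductWith)
open import Data.List.Membership.Propositional using (_∈_)
open import Data.List.Membership.Propositional.Properties using
  (∈-allFin; ∈-cartesianProduct⁺; ∈-cartesianProduct⁻; ∈-cartesianProductWith⁺)
open import Data.List.Properties using (++-assoc; filter-++; foldl-++; length-tabulate; map-tabulate)
open import Data.List.Relation.Binary.Permutation.Propositional using
  (_↭_; prep; ↭-refl; ↭-sym; ↭-trans; module PermutationReasoning)
open import Data.List.Relation.Binary.Permutation.Propositional.Properties using (shift; ++⁺ʳ; ++⁺ˡ)
open import Data.List.Relation.Unary.Any using (here; there)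
open import Data.Nat
open import Data.Nat.Properties
open import Data.Nat.Tactic.RingSolver using (solve-∀)
open import Data.Product using (Σ; ∃; _×_; _,_; proj₁; proj₂)
open import Data.Sum using (_⊎_; inj₁; inj₂)
open import Data.Sum.Function.Propositional using (_⊎-↔_)
open import Data.Unit using (⊤; tt)
open import Data.Vec using (Vec; []; _∷_; lookup)
import Data.Vec.Functional as VF
open import Function using (_∘_; id)
open import Function.Bundles using (_↔_; mk↔ₛ′; Injection; Inverse)
open import Function.Properties.Inverse using (↔-refl; ↔-sym; ↔-trans; ↔⇒↣)
open import Relation.Binary.Definitions using (tri<; tri≈; tri>)
open import Relation.Binary.PropositionalEquality using
  (_≡_; _≢_; refl; sym; trans; cong; cong₂; subst; subst₂; module ≡-Reasoning)
open import Relation.Nullary using (¬_; Dec; yes; no; does)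
open import Relation.Nullary.Decidable using (dec-true; _×-dec_)
open import Relation.Unary using (Pred; Decidable)

open StreamAlg

-- A hard input is a tree with p levels of large arity t above one binary level, in which every
-- inner node points to one of its children. The leaves are ranked lexicographically, the child
-- pointed to coming last among its siblings, so the sink is the leaf reached from the root along
-- the pointers. The stream presents first the pairs of leaves that separate at the deepest nodes;
-- hence a pass reads the lower pointers before the upper one that tells which of them matter.
--
-- Let k = 120p copies with independent seeds run in parallel. For suitable seeds the mean over all
-- inputs of 2 ^ #(wrong copies) is at most (4/3) ^ k. An adversary maintains a product of dense sets
-- of pointer functions, one for every level. In each pass it fixes a popular transcript of the
-- levels below the current node and then the pointer of this node, which multiplies the mean by at
-- most 64. The next pointer remains almost free, because a dense set of functions has few
-- coordinates on which many values are rare. After p passes the memory is constant, while both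
-- leaves below the last node have probability at least 1/16, and for one of them at least half of
-- the copies are wrong: 2 ^ (k/2) ≤ 16 · 64 ^ p · (4/3) ^ k, which is false.

private variable
  X Y Z : Set
  N P S m : ℕ
  ms : List ℕ

-- Finite sums

∑ : List X → (X → ℕ) → ℕ
∑ []       f = 0
∑ (x ∷ xs) f = f x + ∑ xs f

∑-cong : (xs : List X) {f g : X → ℕ} → (∀ x → f x ≡ g x) → ∑ xs f ≡ ∑ xs g
∑-cong []       e = refl
∑-cong (x ∷ xs) e = cong₂ _+_ (e x) (∑-cong xs e)

∑-cong-∈ : (xs : List X) {f g : X → ℕ} → (∀ x → x ∈ xs → f x ≡ g x) → ∑ xs f ≡ ∑ xs g
∑-cong-∈ []       e = refl
∑-cong-∈ (x ∷ xs) e = cong₂ _+_ (e x (here refl)) (∑-cong-∈ xs (λ y → e y ∘ there))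

∑-mono : (xs : List X) {f g : X → ℕ} → (∀ x → f x ≤ g x) → ∑ xs f ≤ ∑ xs g
∑-mono []       e = z≤n
∑-mono (x ∷ xs) e = +-mono-≤ (e x) (∑-mono xs e)

∑-+ : (xs : List X) (f g : X → ℕ) → ∑ xs (λ x → f x + g x) ≡ ∑ xs f + ∑ xs g
∑-+ []       f g = refl
∑-+ (x ∷ xs) f g rewrite ∑-+ xs f g = interchange (f x) (g x) (∑ xs f) (∑ xs g)
  where
  interchange : ∀ a b c d → a + b + (c + d) ≡ a + c + (b + d)
  interchange = solve-∀

∑-*ˡ : (xs : List X) (c : ℕ) (f : X → ℕ) → ∑ xs (λ x → c * f x) ≡ c * ∑ xs f
∑-*ˡ []       c f = sym (*-zeroʳ c)
∑-*ˡ (x ∷ xs) c f rewrite ∑-*ˡ xs c f = sym (*-distribˡ-+ c (f x) (∑ xs f))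

∑-*ʳ : (xs : List X) (f : X → ℕ) (c : ℕ) → ∑ xs (λ x → f x * c) ≡ ∑ xs f * c
∑-*ʳ xs f c = trans (∑-cong xs (λ x → *-comm (f x) c)) (trans (∑-*ˡ xs c f) (*-comm c (∑ xs f)))

∑-const : (xs : List X) (c : ℕ) → ∑ xs (λ _ → c) ≡ length xs * c
∑-const []       c = refl
∑-const (x ∷ xs) c = cong (c +_) (∑-const xs c)

∑-swap : (xs : List X) (ys : List Y) (f : X → Y → ℕ) →
         ∑ xs (λ x → ∑ ys (f x)) ≡ ∑ ys (λ y → ∑ xs (λ x → f x y))
∑-swap []       ys f = sym (trans (∑-const ys 0) (*-zeroʳ (length ys)))
∑-swap (x ∷ xs) ys f =
  trans (cong (∑ ys (f x) +_) (∑-swap xs ys f)) (sym (∑-+ ys (f x) _))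

∑-map : (h : X → Y) (xs : List X) (f : Y → ℕ) → ∑ (map h xs) f ≡ ∑ xs (f ∘ h)
∑-map h []       f = refl
∑-map h (x ∷ xs) f = cong (f (h x) +_) (∑-map h xs f)

∑-++ : (xs ys : List X) (f : X → ℕ) → ∑ (xs ++ ys) f ≡ ∑ xs f + ∑ ys f
∑-++ []       ys f = refl
∑-++ (x ∷ xs) ys f = trans (cong (f x +_) (∑-++ xs ys f)) (sym (+-assoc (f x) _ _))

∈-≤-∑ : {xs : List X} {x : X} → x ∈ xs → (f : X → ℕ) → f x ≤ ∑ xs f
∈-≤-∑ (here refl)         f = m≤m+n _ _
∈-≤-∑ {xs = y ∷ _} (there p) f = ≤-trans (∈-≤-∑ p f) (m≤n+m _ (f y))

-- Averaging: if `g` were below `f` at every entry, the sums would compare strictly the other way.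
-- Messages, pointer functions and seeds are all chosen through this.
∑-≤⇒∃ : (xs : List X) {f g : X → ℕ} → 0 < length xs → ∑ xs f ≤ ∑ xs g →
        ∃ λ x → x ∈ xs × f x ≤ g x
∑-≤⇒∃ {X} (x ∷ xs) {f} {g} _ = go x xs
  where
  go : ∀ x xs → ∑ (x ∷ xs) f ≤ ∑ (x ∷ xs) g → ∃ λ z → z ∈ x ∷ xs × f z ≤ g z
  go x [] le = x , here refl , subst₂ _≤_ (+-identityʳ (f x)) (+-identityʳ (g x)) le
  go x (y ∷ xs) le with f x ≤? g x
  ... | yes p = x , here refl , p
  ... | no ¬p with go y xs (≮⇒≥ (λ gt → <⇒≱ (+-mono-< (≰⇒> ¬p) gt) le))
  ...   | z , z∈ , q = z , there z∈ , q

𝟙 : Bool → ℕ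
𝟙 true  = 1
𝟙 false = 0

∑-filterᵇ : (b : X → Bool) (xs : List X) (f : X → ℕ) →
            ∑ (filterᵇ b xs) f ≡ ∑ xs (λ x → 𝟙 (b x) * f x)
∑-filterᵇ b []       f = refl
∑-filterᵇ b (x ∷ xs) f with b x
... | true  = cong₂ _+_ (sym (+-identityʳ (f x))) (∑-filterᵇ b xs f)
... | false = ∑-filterᵇ b xs f

length≡∑ : (xs : List X) → length xs ≡ ∑ xs (λ _ → 1)
length≡∑ xs = sym (trans (∑-const xs 1) (*-identityʳ (length xs)))

length-filterᵇ : (b : X → Bool) (xs : List X) → length (filterᵇ b xs) ≡ ∑ xs (𝟙 ∘ b)
length-filterᵇ b xs =
  trans (length≡∑ (filterᵇ b xs))
    (trans (∑-filterᵇ b xs (λ _ → 1)) (∑-cong xs (λ x → *-identityʳ _)))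

∈-filterᵇ : (b : X → Bool) (xs : List X) {x : X} →
            x ∈ filterᵇ b xs → x ∈ xs × b x ≡ true
∈-filterᵇ b (y ∷ xs) x∈ with b y in eq
∈-filterᵇ b (y ∷ xs) (here refl) | true = here refl , eq
∈-filterᵇ b (y ∷ xs) (there x∈)  | true with ∈-filterᵇ b xs x∈
... | p , q = there p , q
∈-filterᵇ b (y ∷ xs) x∈          | false with ∈-filterᵇ b xs x∈
... | p , q = there p , q

∑-filterᵇ-≤ : (b : X → Bool) (xs : List X) (f : X → ℕ) → ∑ (filterᵇ b xs) f ≤ ∑ xs f
∑-filterᵇ-≤ b xs f = ≤-trans (≤-reflexive (∑-filterᵇ b xs f)) (∑-mono xs (λ x → 𝟙*≤ (b x) (f x)))
  where
  𝟙*≤ : ∀ b n → 𝟙 b * n ≤ n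
  𝟙*≤ true  n = ≤-reflexive (*-identityˡ n)
  𝟙*≤ false n = z≤n

∑-allFin-suc : ∀ {n} (f : Fin (suc n) → ℕ) →
               ∑ (allFin (suc n)) f ≡ f zero + ∑ (allFin n) (f ∘ suc)
∑-allFin-suc {n} f = cong (f zero +_)
  (trans (cong (λ xs → ∑ xs f) (sym (map-tabulate id suc))) (∑-map suc (allFin n) f))

length-allFin : ∀ n → length (allFin n) ≡ n
length-allFin n = length-tabulate {n = n} id

∑-allFin-const : ∀ n c → ∑ (allFin n) (λ _ → c) ≡ n * c
∑-allFin-const n c = trans (∑-const (allFin n) c) (cong (_* c) (length-allFin n))

infix 4 _==_

_==_ : ∀ {n} → Fin n → Fin n → Bool
i == j = does (i Fin.≟ j)

==-refl : ∀ {n} (i : Fin n) → (i == i) ≡ true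
==-refl i with i Fin.≟ i
... | yes _ = refl
... | no ¬p = ⊥-elim (¬p refl)

==⇒≡ : ∀ {n} (i j : Fin n) → (i == j) ≡ true → i ≡ j
==⇒≡ i j e with i Fin.≟ j
... | yes p = p

∑-δ : ∀ {n} (i : Fin n) (f : Fin n → ℕ) → ∑ (allFin n) (λ j → 𝟙 (i == j) * f j) ≡ f i
∑-δ {suc n} zero f =
  trans (∑-allFin-suc {n} (λ j → 𝟙 (zero == j) * f j))
    (trans (cong (f zero + 0 +_) (trans (∑-allFin-const n 0) (*-zeroʳ n)))
      (trans (+-identityʳ (f zero + 0)) (+-identityʳ (f zero))))
∑-δ {suc n} (suc i) f =
  trans (∑-allFin-suc {n} (λ j → 𝟙 (suc i == j) * f j)) (∑-δ i (f ∘ suc))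

∑-fibres : ∀ {n} (k : X → Fin n) (xs : List X) (f : X → ℕ) →
           ∑ (allFin n) (λ j → ∑ (filterᵇ (λ x → k x == j) xs) f) ≡ ∑ xs f
∑-fibres {n = n} k xs f =
  trans (∑-cong (allFin n) (λ j → ∑-filterᵇ (λ x → k x == j) xs f))
    (trans (∑-swap (allFin n) xs _) (∑-cong xs (λ x → ∑-δ (k x) (λ _ → f x))))

∑-fibres-length : ∀ {n} (k : X → Fin n) (xs : List X) →
  ∑ (allFin n) (λ j → length (filterᵇ (λ x → k x == j) xs)) ≡ length xs
∑-fibres-length k xs =
  trans (∑-cong (allFin _) (λ j → length≡∑ (filterᵇ (λ x → k x == j) xs)))
    (trans (∑-fibres k xs (λ _ → 1)) (sym (length≡∑ xs)))

∑-↑ : ∀ m n (f : Fin (m + n) → ℕ) →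
      ∑ (allFin (m + n)) f ≡ ∑ (allFin m) (f ∘ (_↑ˡ n)) + ∑ (allFin n) (f ∘ (m ↑ʳ_))
∑-↑ zero    n f = refl
∑-↑ (suc m) n f = begin
  ∑ (allFin (suc m + n)) f
    ≡⟨ ∑-allFin-suc {m + n} f ⟩
  f zero + ∑ (allFin (m + n)) (f ∘ suc)
    ≡⟨ cong (f zero +_) (∑-↑ m n (f ∘ suc)) ⟩
  f zero + (∑ (allFin m) (f ∘ suc ∘ (_↑ˡ n)) + ∑ (allFin n) (f ∘ (suc m ↑ʳ_)))
    ≡⟨ +-assoc (f zero) _ _ ⟨
  f zero + ∑ (allFin m) (f ∘ suc ∘ (_↑ˡ n)) + ∑ (allFin n) (f ∘ (suc m ↑ʳ_))
    ≡⟨ cong (_+ ∑ (allFin n) (f ∘ (suc m ↑ʳ_))) (∑-allFin-suc {m} (f ∘ (_↑ˡ n))) ⟨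
  ∑ (allFin (suc m)) (f ∘ (_↑ˡ n)) + ∑ (allFin n) (f ∘ (suc m ↑ʳ_)) ∎
  where open ≡-Reasoning

∑-combine : ∀ m n (f : Fin (m * n) → ℕ) →
            ∑ (allFin (m * n)) f ≡ ∑ (allFin m) (λ i → ∑ (allFin n) (f ∘ combine i))
∑-combine zero    n f = refl
∑-combine (suc m) n f = begin
  ∑ (allFin (n + m * n)) f
    ≡⟨ ∑-↑ n (m * n) f ⟩
  ∑ (allFin n) (f ∘ (_↑ˡ m * n)) + ∑ (allFin (m * n)) (f ∘ (n ↑ʳ_))
    ≡⟨ cong (∑ (allFin n) (f ∘ (_↑ˡ m * n)) +_) (∑-combine m n (f ∘ (n ↑ʳ_))) ⟩
  ∑ (allFin n) (f ∘ combine {suc m} zero) + ∑ (allFin m) (λ i → ∑ (allFin n) (f ∘ combine (suc i)))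
    ≡⟨ ∑-allFin-suc {m} (λ i → ∑ (allFin n) (f ∘ combine i)) ⟨
  ∑ (allFin (suc m)) (λ i → ∑ (allFin n) (f ∘ combine i)) ∎
  where open ≡-Reasoning

count : ∀ {n} → (Fin n → Bool) → ℕ
count {n} b = ∑ (allFin n) (𝟙 ∘ b)

count-suc : ∀ {n} (b : Fin (suc n) → Bool) → count b ≡ 𝟙 (b zero) + count (b ∘ suc)
count-suc {n} b = ∑-allFin-suc {n} (𝟙 ∘ b)

-- Cuts a set of candidates down to the exact size `8 * q` that `dense⇒balanced` takes.
shrink : ∀ {n} (b : Fin n → Bool) k → k ≤ count b →
         ∃ λ b′ → (∀ i → b′ i ≡ true → b i ≡ true) × count {n} b′ ≡ k
shrink {zero}  b zero    le = b , (λ _ e → e) , refl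
shrink {suc n} b k       le = go k (b zero) refl (subst (k ≤_) (count-suc b) le)
  where
  go : ∀ k b₀ → b zero ≡ b₀ → k ≤ 𝟙 (b zero) + count (b ∘ suc) →
       ∃ λ b′ → (∀ i → b′ i ≡ true → b i ≡ true) × count {suc n} b′ ≡ k
  go zero    b₀    eq le = (λ _ → false) , (λ _ ()) , trans (∑-allFin-const (suc n) 0) (*-zeroʳ n)
  go (suc k) true  eq le
    with shrink (b ∘ suc) k (s≤s⁻¹ (subst (λ z → suc k ≤ 𝟙 z + count (b ∘ suc)) eq le))
  ... | b′ , sub , c = true VF.∷ b′ , (λ { zero _ → eq ; (suc i) → sub i })
      , trans (count-suc (true VF.∷ b′)) (cong suc c)
  go (suc k) false eq le
    with shrink (b ∘ suc) (suc k) (subst (λ z → suc k ≤ 𝟙 z + count (b ∘ suc)) eq le)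
  ... | b′ , sub , c = false VF.∷ b′ , (λ { zero () ; (suc i) → sub i })
      , trans (count-suc (false VF.∷ b′)) c

-- Dense subsets of a cube

^-distribʳ-* : ∀ n a b → (a * b) ^ n ≡ a ^ n * b ^ n
^-distribʳ-* zero    a b = refl
^-distribʳ-* (suc n) a b = trans (cong (a * b *_) (^-distribʳ-* n a b)) (rearrange a b (a ^ n) (b ^ n))
  where
  rearrange : ∀ a b c d → a * b * (c * d) ≡ a * c * (b * d)
  rearrange = solve-∀

∏ : ∀ N → (Fin N → ℕ) → ℕ
∏ zero    f = 1
∏ (suc N) f = f zero * ∏ N (f ∘ suc)

∏-mono : ∀ N {f g : Fin N → ℕ} → (∀ i → f i ≤ g i) → ∏ N f ≤ ∏ N g
∏-mono zero    le = ≤-refl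
∏-mono (suc N) le = *-mono-≤ (le zero) (∏-mono N (le ∘ suc))

∏-^ : ∀ b N (a : Fin N → ℕ) → ∏ N (λ i → b ^ a i) ≡ b ^ ∑ (allFin N) a
∏-^ b zero    a = refl
∏-^ b (suc N) a = begin
  b ^ a zero * ∏ N (λ i → b ^ a (suc i))      ≡⟨ cong (b ^ a zero *_) (∏-^ b N (a ∘ suc)) ⟩
  b ^ a zero * b ^ ∑ (allFin N) (a ∘ suc)     ≡⟨ ^-distribˡ-+-* b (a zero) _ ⟨
  b ^ (a zero + ∑ (allFin N) (a ∘ suc))       ≡⟨ cong (b ^_) (∑-allFin-suc {N} a) ⟨
  b ^ ∑ (allFin (suc N)) a ∎
  where open ≡-Reasoning

∏-*-const : ∀ N (f : Fin N → ℕ) m → ∏ N (λ i → f i * m) ≡ ∏ N f * m ^ N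
∏-*-const zero    f m = refl
∏-*-const (suc N) f m = trans (cong (f zero * m *_) (∏-*-const N (f ∘ suc) m))
                              (rearrange (f zero) m (∏ N (f ∘ suc)) (m ^ N))
  where
  rearrange : ∀ a m b c → a * m * (b * c) ≡ a * b * (m * c)
  rearrange = solve-∀

∑-cartesianProductWith : (h : X → Y → Z) (xs : List X) (ys : List Y) (f : Z → ℕ) →
  ∑ (cartesianProductWith h xs ys) f ≡ ∑ xs (λ x → ∑ ys (λ y → f (h x y)))
∑-cartesianProductWith h []       ys f = refl
∑-cartesianProductWith h (x ∷ xs) ys f =
  trans (∑-++ (map (h x) ys) _ f)
    (cong₂ _+_ (∑-map (h x) ys f) (∑-cartesianProductWith h xs ys f))

allVecs : ∀ m N → List (Vec (Fin m) N)
allVecs m zero    = [] ∷ []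
allVecs m (suc N) = cartesianProductWith _∷_ (allFin m) (allVecs m N)

∑-allVecs-∏ : ∀ m N (g : Fin N → Fin m → ℕ) →
  ∑ (allVecs m N) (λ x → ∏ N (λ i → g i (lookup x i))) ≡ ∏ N (λ i → ∑ (allFin m) (g i))
∑-allVecs-∏ m zero    g = refl
∑-allVecs-∏ m (suc N) g = begin
  ∑ (allVecs m (suc N)) (λ x → ∏ (suc N) (λ i → g i (lookup x i)))
    ≡⟨ ∑-cartesianProductWith _∷_ (allFin m) (allVecs m N) _ ⟩
  ∑ (allFin m) (λ y → ∑ (allVecs m N) (λ x → g zero y * ∏ N (λ i → g (suc i) (lookup x i))))
    ≡⟨ ∑-cong (allFin m) (λ y → trans (∑-*ˡ (allVecs m N) (g zero y) _)
         (cong (g zero y *_) (∑-allVecs-∏ m N (g ∘ suc)))) ⟩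
  ∑ (allFin m) (λ y → g zero y * ∏ N (λ i → ∑ (allFin m) (g (suc i))))
    ≡⟨ ∑-*ʳ (allFin m) (g zero) _ ⟩
  ∏ (suc N) (λ i → ∑ (allFin m) (g i)) ∎
  where open ≡-Reasoning

length-allVecs : ∀ m N → length (allVecs m N) ≡ m ^ N
length-allVecs m N = begin
  length (allVecs m N)                            ≡⟨ length≡∑ (allVecs m N) ⟩
  ∑ (allVecs m N) (λ _ → 1)                       ≡⟨ ∑-cong (allVecs m N) (λ _ → sym (∏-1 N)) ⟩
  ∑ (allVecs m N) (λ x → ∏ N (λ _ → 1))           ≡⟨ ∑-allVecs-∏ m N (λ _ _ → 1) ⟩
  ∏ N (λ _ → ∑ (allFin m) (λ _ → 1))              ≡⟨ ∏-cong-const N ⟩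
  ∏ N (λ _ → 1 * m)                               ≡⟨ ∏-*-const N (λ _ → 1) m ⟩
  ∏ N (λ _ → 1) * m ^ N                           ≡⟨ cong (_* m ^ N) (∏-1 N) ⟩
  1 * m ^ N                                       ≡⟨ *-identityˡ _ ⟩
  m ^ N ∎
  where
  open ≡-Reasoning
  ∏-1 : ∀ N → ∏ N (λ _ → 1) ≡ 1
  ∏-1 zero    = refl
  ∏-1 (suc N) = trans (+-identityʳ _) (∏-1 N)
  ∏-cong-const : ∀ N → ∏ N (λ _ → ∑ (allFin m) (λ _ → 1)) ≡ ∏ N (λ _ → 1 * m)
  ∏-cong-const N = cong (λ z → ∏ N (λ _ → z)) (trans (∑-allFin-const m 1) (*-comm m 1))

-- Expresses that A, as a subset of the cube, lists no vector twice.
_⊑all : ∀ {m N} → List (Vec (Fin m) N) → Set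
_⊑all {m} {N} A = ∀ h → ∑ A h ≤ ∑ (allVecs m N) h

fibre : ∀ {m N} → List (Vec (Fin m) N) → Fin N → Fin m → List (Vec (Fin m) N)
fibre A i y = filterᵇ (λ x → lookup x i == y) A

-- A rare value: its share of `A` is below an eighth of the uniform share `1 / m`. All light values
-- at one coordinate together then cover at most an eighth of `A`.
light : ∀ {m N} → List (Vec (Fin m) N) → Fin N → Fin m → Bool
light {m} A i y = 8 * m * length (fibre A i y) <ᵇ length A

light-≤ : ∀ {m N} (A : List (Vec (Fin m) N)) i y → light A i y ≡ true →
          8 * m * length (fibre A i y) ≤ length A
light-≤ {m} A i y e = <⇒≤ (<ᵇ⇒< _ _ (subst T (sym e) _))

heavy-≥ : ∀ {m N} (A : List (Vec (Fin m) N)) i y → light A i y ≡ false →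
          length A ≤ 8 * m * length (fibre A i y)
heavy-≥ {m} A i y e = ≮⇒≥ (λ lt → subst T e (<⇒<ᵇ lt))

-- For `m ≡ 2` this leaves no light value at all.
Balanced : ∀ {m N} → List (Vec (Fin m) N) → Fin N → Set
Balanced {m} A i = 2 * count (light A i) < m

balanced? : ∀ {m N} (A : List (Vec (Fin m) N)) i → Dec (Balanced A i)
balanced? A i = _ <? _

-- A line supporting `3 ^ x` on the integers and touching it at `x = a`: `3 ^ κ ≥ b * (1 + κ - a)`,
-- where `κ - a = q - l`. The form avoids subtraction; summed over `A` it is the convexity step of
-- `dense⇒balanced`.
3^-tangent : ∀ a b q κ l → κ + l ≡ a + q → b ≡ 3 ^ a → b + b * q ≤ 3 ^ κ + b * l
3^-tangent a b q κ l eq refl with l ≤? q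
... | no l≰q = ≤-trans (≤-reflexive (sym (*-suc (3 ^ a) q)))
                 (≤-trans (*-monoʳ-≤ (3 ^ a) (≰⇒> l≰q)) (m≤n+m _ (3 ^ κ)))
... | yes l≤q with r , refl ← m≤n⇒∃[o]m+o≡n l≤q = begin
  3 ^ a + 3 ^ a * (l + r)            ≡⟨ rearrange (3 ^ a) l r ⟩
  3 ^ a * (1 + r) + 3 ^ a * l        ≤⟨ +-monoˡ-≤ _ (*-monoʳ-≤ (3 ^ a) (n<3^n r)) ⟩
  3 ^ a * 3 ^ r + 3 ^ a * l          ≡⟨ cong (_+ 3 ^ a * l) (^-distribˡ-+-* 3 a r) ⟨
  3 ^ (a + r) + 3 ^ a * l            ≡⟨ cong (λ z → 3 ^ z + 3 ^ a * l) κ≡ ⟨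
  3 ^ κ + 3 ^ a * l ∎
  where
  open ≤-Reasoning
  rearrange : ∀ b l r → b + b * (l + r) ≡ b * (1 + r) + b * l
  rearrange = solve-∀
  κ≡ : κ ≡ a + r
  κ≡ = +-cancelʳ-≡ l κ (a + r) (trans eq (move a l r))
    where
    move : ∀ a l r → a + (l + r) ≡ a + r + l
    move = solve-∀
  n<3^n : ∀ n → 1 + n ≤ 3 ^ n
  n<3^n zero    = ≤-refl
  n<3^n (suc n) = ≤-trans (s≤s (n<3^n n)) (≤-trans (+-monoˡ-≤ (3 ^ n) (m^n>0 3 n)) (+-monoʳ-≤ (3 ^ n) (m≤m+n (3 ^ n) _)))

-- If no coordinate in J is balanced, the mean of 3 ^ #{ i ∈ J | x i is not light } over the cube
-- is at most 2 ^ |J|. Over A, at most q of the 8q coordinates in J are light on average, so by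
-- convexity the mean is at least 3 ^ (7q), which exceeds 2 ^ (8q) 8 ^ q.
dense⇒balanced : ∀ {m N} (A : List (Vec (Fin m) N)) P q (J : Fin N → Bool) →
  A ⊑all → 0 < length A → m ^ N ≤ P * length A → P < 8 ^ q → count J ≡ 8 * q →
  (∀ i → J i ≡ true → ¬ Balanced A i) → ⊥
dense⇒balanced {m} {N} A P q J A⊑ A>0 dense P<8^q |J| unb = <-irrefl refl (begin-strict
  3 ^ (7 * q) * length A            ≤⟨ lower ⟩
  ∑ A (λ x → 3 ^ κ x)               ≤⟨ upper ⟩
  2 ^ (8 * q) * m ^ N               ≤⟨ *-monoʳ-≤ (2 ^ (8 * q)) dense ⟩
  2 ^ (8 * q) * (P * length A)      ≡⟨ *-assoc (2 ^ (8 * q)) P _ ⟨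
  2 ^ (8 * q) * P * length A        <⟨ *-monoˡ-< (length A) {{>-nonZero A>0}} numeric ⟩
  3 ^ (7 * q) * length A ∎)
  where
  open ≤-Reasoning
  L H : Fin N → Fin m → Bool
  L i y = J i ∧ light A i y
  H i y = J i ∧ not (light A i y)
  κ l : Vec (Fin m) N → ℕ
  κ x = ∑ (allFin N) (λ i → 𝟙 (H i (lookup x i)))
  l x = ∑ (allFin N) (λ i → 𝟙 (L i (lookup x i)))

  -- The constants fit because `2 ^ 8 * 8 = 2048` is below `3 ^ 7 = 2187`.
  numeric : 2 ^ (8 * q) * P < 3 ^ (7 * q)
  numeric = begin-strict
    2 ^ (8 * q) * P           <⟨ *-monoʳ-< (2 ^ (8 * q)) {{m^n≢0 2 (8 * q)}} P<8^q ⟩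
    2 ^ (8 * q) * 8 ^ q       ≡⟨ cong (_* 8 ^ q) (^-*-assoc 2 8 q) ⟨
    256 ^ q * 8 ^ q           ≡⟨ ^-distribʳ-* q 256 8 ⟨
    2048 ^ q                  ≤⟨ ^-monoˡ-≤ q (≤ᵇ⇒≤ 2048 2187 _) ⟩
    2187 ^ q                  ≡⟨ ^-*-assoc 3 7 q ⟩
    3 ^ (7 * q) ∎

  κ+l : ∀ x → κ x + l x ≡ 7 * q + q
  κ+l x = trans (sym (∑-+ (allFin N) _ _))
    (trans (∑-cong (allFin N) (λ i → split (J i) (light A i (lookup x i)))) (trans |J| (+-comm q (7 * q))))
    where
    split : ∀ j b → 𝟙 (j ∧ not b) + 𝟙 (j ∧ b) ≡ 𝟙 j
    split true  true  = refl
    split true  false = refl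
    split false b     = refl

  -- At most `m` values are light, each with a share of at most `1 / (8 * m)` of `A`.
  lightAt : ∀ i → 8 * ∑ A (λ x → 𝟙 (L i (lookup x i))) ≤ 𝟙 (J i) * length A
  lightAt i with J i
  ... | false = ≤-reflexive (trans (cong (8 *_) (trans (∑-const A 0) (*-zeroʳ (length A)))) refl)
  ... | true with m ≟ 0
  -- Cancelling `m` needs `m ≢ 0`; over an empty alphabet no vector has a coordinate `i`.
  ...   | yes refl = ⊥-elim (noVec A A>0 i)
    where
    noVec : ∀ {N} (A : List (Vec (Fin 0) N)) → 0 < length A → Fin N → ⊥
    noVec (x ∷ _) _ i with () ← lookup x i
  ...   | no m≢0 = *-cancelˡ-≤ m {{≢-nonZero m≢0}} (begin
    m * (8 * ∑ A (λ x → 𝟙 (light A i (lookup x i))))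
      ≡⟨ rearrange m _ ⟩
    8 * m * ∑ A (λ x → 𝟙 (light A i (lookup x i)))
      ≡⟨ cong (8 * m *_) (∑-fibres (λ x → lookup x i) A _) ⟨
    8 * m * ∑ (allFin m) (λ y → ∑ (fibre A i y) (λ x → 𝟙 (light A i (lookup x i))))
      ≡⟨ cong (8 * m *_) (∑-cong (allFin m) (λ y → trans
           (∑-cong-∈ (fibre A i y) (λ x x∈ → cong (𝟙 ∘ light A i)
             (==⇒≡ _ _ (proj₂ (∈-filterᵇ (λ x → lookup x i == y) A x∈)))))
           (∑-const (fibre A i y) _))) ⟩
    8 * m * ∑ (allFin m) (λ y → length (fibre A i y) * 𝟙 (light A i y))
      ≡⟨ ∑-*ˡ (allFin m) (8 * m) _ ⟨
    ∑ (allFin m) (λ y → 8 * m * (length (fibre A i y) * 𝟙 (light A i y)))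
      ≤⟨ ∑-mono (allFin m) small ⟩
    ∑ (allFin m) (λ y → length A)
      ≡⟨ ∑-allFin-const m (length A) ⟩
    m * length A
      ≡⟨ cong (m *_) (*-identityˡ (length A)) ⟨
    m * (1 * length A) ∎)
    where
    rearrange : ∀ m s → m * (8 * s) ≡ 8 * m * s
    rearrange = solve-∀
    small : ∀ y → 8 * m * (length (fibre A i y) * 𝟙 (light A i y)) ≤ length A
    small y with light A i y in eq
    ... | true  = ≤-trans (≤-reflexive (cong (8 * m *_) (*-identityʳ _))) (light-≤ A i y eq)
    ... | false = ≤-trans (≤-reflexive (trans (cong (8 * m *_) (*-zeroʳ (length (fibre A i y)))) (*-zeroʳ (8 * m)))) z≤n

  ∑l : ∑ A l ≤ q * length A
  ∑l = *-cancelˡ-≤ 8 (begin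
    8 * ∑ A l
      ≡⟨ cong (8 *_) (∑-swap A (allFin N) _) ⟩
    8 * ∑ (allFin N) (λ i → ∑ A (λ x → 𝟙 (L i (lookup x i))))
      ≡⟨ ∑-*ˡ (allFin N) 8 _ ⟨
    ∑ (allFin N) (λ i → 8 * ∑ A (λ x → 𝟙 (L i (lookup x i))))
      ≤⟨ ∑-mono (allFin N) lightAt ⟩
    ∑ (allFin N) (λ i → 𝟙 (J i) * length A)
      ≡⟨ ∑-*ʳ (allFin N) (𝟙 ∘ J) (length A) ⟩
    count J * length A
      ≡⟨ cong (_* length A) |J| ⟩
    8 * q * length A
      ≡⟨ *-assoc 8 q (length A) ⟩
    8 * (q * length A) ∎)

  lower : 3 ^ (7 * q) * length A ≤ ∑ A (λ x → 3 ^ κ x)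
  lower = +-cancelʳ-≤ (3 ^ (7 * q) * (q * length A)) _ _ (begin
    b * length A + b * (q * length A)
      ≡⟨ rearrange b (length A) q ⟩
    length A * (b + b * q)
      ≡⟨ ∑-const A _ ⟨
    ∑ A (λ _ → b + b * q)
      ≤⟨ ∑-mono A (λ x → 3^-tangent (7 * q) b q (κ x) (l x) (κ+l x) refl) ⟩
    ∑ A (λ x → 3 ^ κ x + b * l x)
      ≡⟨ trans (∑-+ A _ _) (cong (∑ A (λ x → 3 ^ κ x) +_) (∑-*ˡ A b l)) ⟩
    ∑ A (λ x → 3 ^ κ x) + b * ∑ A l
      ≤⟨ +-monoʳ-≤ (∑ A (λ x → 3 ^ κ x)) (*-monoʳ-≤ b ∑l) ⟩
    ∑ A (λ x → 3 ^ κ x) + b * (q * length A) ∎)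
    where
    b = 3 ^ (7 * q)
    rearrange : ∀ b a q → b * a + b * (q * a) ≡ a * (b + b * q)
    rearrange = solve-∀

  -- For `i` in `J`, light values weigh 1 and the others 3; as at least half are light, the mean
  -- weight is at most 2.
  row : ∀ i → ∑ (allFin m) (λ y → 3 ^ 𝟙 (H i y)) ≤ 2 ^ 𝟙 (J i) * m
  row i with J i in Ji
  ... | false = ≤-reflexive (trans (∑-allFin-const m 1) (*-comm m 1))
  ... | true  = +-cancelʳ-≤ (2 * count (light A i)) _ _ (begin
    ∑ (allFin m) (λ y → 3 ^ 𝟙 (not (light A i y))) + 2 * count (light A i)
      ≡⟨ cong (∑ (allFin m) (λ y → 3 ^ 𝟙 (not (light A i y))) +_) (∑-*ˡ (allFin m) 2 _) ⟨
    ∑ (allFin m) (λ y → 3 ^ 𝟙 (not (light A i y))) + ∑ (allFin m) (λ y → 2 * 𝟙 (light A i y))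
      ≡⟨ ∑-+ (allFin m) _ _ ⟨
    ∑ (allFin m) (λ y → 3 ^ 𝟙 (not (light A i y)) + 2 * 𝟙 (light A i y))
      ≡⟨ ∑-cong (allFin m) (λ y → three (light A i y)) ⟩
    ∑ (allFin m) (λ y → 3)
      ≡⟨ trans (∑-allFin-const m 3) (times3 m) ⟩
    2 * m + m
      ≤⟨ +-monoʳ-≤ (2 * m) (≮⇒≥ (unb i Ji)) ⟩
    2 * m + 2 * count (light A i) ∎)
    where
    three : ∀ b → 3 ^ 𝟙 (not b) + 2 * 𝟙 b ≡ 3
    three true  = refl
    three false = refl
    times3 : ∀ m → m * 3 ≡ 2 * m + m
    times3 = solve-∀

  upper : ∑ A (λ x → 3 ^ κ x) ≤ 2 ^ (8 * q) * m ^ N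
  upper = begin
    ∑ A (λ x → 3 ^ κ x)
      ≤⟨ A⊑ _ ⟩
    ∑ (allVecs m N) (λ x → 3 ^ κ x)
      ≡⟨ ∑-cong (allVecs m N) (λ x → sym (∏-^ 3 N (λ i → 𝟙 (H i (lookup x i))))) ⟩
    ∑ (allVecs m N) (λ x → ∏ N (λ i → 3 ^ 𝟙 (H i (lookup x i))))
      ≡⟨ ∑-allVecs-∏ m N (λ i y → 3 ^ 𝟙 (H i y)) ⟩
    ∏ N (λ i → ∑ (allFin m) (λ y → 3 ^ 𝟙 (H i y)))
      ≤⟨ ∏-mono N row ⟩
    ∏ N (λ i → 2 ^ 𝟙 (J i) * m)
      ≡⟨ ∏-*-const N (λ i → 2 ^ 𝟙 (J i)) m ⟩
    ∏ N (λ i → 2 ^ 𝟙 (J i)) * m ^ N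
      ≡⟨ cong (_* m ^ N) (trans (∏-^ 2 N (𝟙 ∘ J)) (cong (2 ^_) |J|)) ⟩
    2 ^ (8 * q) * m ^ N ∎

-- One pass over the layers of a tree

-- Forests with N roots whose nodes at depth j have arity ms[j]: an input chooses a child
-- at every inner node, layer by layer.
Inputs : ℕ → List ℕ → Set
Inputs N []       = ⊤
Inputs N (m ∷ ms) = Vec (Fin m) N × Inputs (N * m) ms

Rect : ℕ → List ℕ → Set
Rect N []       = ⊤
Rect N (m ∷ ms) = List (Vec (Fin m) N) × Rect (N * m) ms

points : Rect N ms → List (Inputs N ms)
points {ms = []}     _       = tt ∷ []
points {ms = m ∷ ms} (A , R) = cartesianProduct A (points R)

∑-points-∷ : (A : List (Vec (Fin m) N)) (R : Rect (N * m) ms) (e : Inputs N (m ∷ ms) → ℕ) →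
  ∑ (points {ms = m ∷ ms} (A , R)) e ≡ ∑ A (λ f → ∑ (points R) (λ x → e (f , x)))
∑-points-∷ A R e = ∑-cartesianProductWith _,_ A (points R) e

length-points-∷ : (A : List (Vec (Fin m) N)) (R : Rect (N * m) ms) →
  length (points {ms = m ∷ ms} (A , R)) ≡ length A * length (points R)
length-points-∷ {N = N} {ms = ms} A R =
  trans (length≡∑ (points {N} {ms = _ ∷ ms} (A , R))) (trans (∑-points-∷ A R (λ _ → 1))
    (trans (∑-const A _) (cong (length A *_) (sym (length≡∑ (points R))))))

record DenseSet (P : ℕ) {m N} (A : List (Vec (Fin m) N)) : Set where
  constructor denseSet
  field
    ⊑all  : A ⊑all
    nonempty : 0 < length A
    dense : m ^ N ≤ P * length A

open DenseSet

Dense : ℕ → Rect N ms → Set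
Dense {ms = []}     P _       = ⊤
Dense {ms = m ∷ ms} P (A , R) = DenseSet P A × Dense P R

points-nonempty : (R : Rect N ms) → Dense P R → 0 < length (points R)
points-nonempty {ms = []}     R       _       = z<s
points-nonempty {ms = m ∷ ms} (A , R) (d , D) =
  subst (0 <_) (sym (length-points-∷ A R)) (*-mono-≤ (nonempty d) (points-nonempty R D))

-- Layers are streamed from the bottom of the tree to the top.
Trans : ℕ → ℕ → List ℕ → Set
Trans S N []       = ⊤
Trans S N (m ∷ ms) = (Vec (Fin m) N → Fin S → Fin S) × Trans S (N * m) ms

runTrans : Trans S N ms → Inputs N ms → Fin S → Fin S
runTrans {ms = []}     _        _       st = st
runTrans {ms = m ∷ ms} (t , ts) (f , x) st = t f (runTrans ts x st)

-- Both inequalities follow from their sum (suitably scaled), which holds for some j by averaging.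
popular-message : (A : List X) (k : X → Fin S) (e : X → ℕ) (c c₁ α β : ℕ) → c₁ ≡ suc c →
  0 < S → 0 < α → 0 < length A → β * ∑ A e ≤ α * length A →
  ∃ λ j → let A′ = filterᵇ (λ x → k x == j) A in
    c * β * ∑ A′ e ≤ c₁ * α * length A′ × length A ≤ c₁ * S * length A′
popular-message {S = S} A k e c c₁ α β refl S>0 α>0 A>0 hyp = j , cost , large
  where
  A′ : Fin S → List _
  A′ j = filterᵇ (λ x → k x == j) A
  total : ∑ (allFin S) (λ j → c * β * S * ∑ (A′ j) e + α * length A) ≤
          ∑ (allFin S) (λ j → suc c * α * S * length (A′ j))
  total = begin
    ∑ (allFin S) (λ j → c * β * S * ∑ (A′ j) e + α * length A)
      ≡⟨ ∑-+ (allFin S) _ _ ⟩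
    ∑ (allFin S) (λ j → c * β * S * ∑ (A′ j) e) + ∑ (allFin S) (λ _ → α * length A)
      ≡⟨ cong₂ _+_ (trans (∑-*ˡ (allFin S) (c * β * S) _) (cong (c * β * S *_) (∑-fibres k A e)))
                   (∑-allFin-const S _) ⟩
    c * β * S * ∑ A e + S * (α * length A)
      ≡⟨ r₁ c β S (∑ A e) (α * length A) ⟩
    c * S * (β * ∑ A e) + S * (α * length A)
      ≤⟨ +-monoˡ-≤ _ (*-monoʳ-≤ (c * S) hyp) ⟩
    c * S * (α * length A) + S * (α * length A)
      ≡⟨ r₂ c S α (length A) ⟩
    suc c * α * S * length A
      ≡⟨ trans (∑-*ˡ (allFin S) (suc c * α * S) _) (cong (suc c * α * S *_) (∑-fibres-length k A)) ⟨
    ∑ (allFin S) (λ j → suc c * α * S * length (A′ j)) ∎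
    where
    open ≤-Reasoning
    r₁ : ∀ c β S E a → c * β * S * E + S * a ≡ c * S * (β * E) + S * a
    r₁ = solve-∀
    r₂ : ∀ c S α a → c * S * (α * a) + S * (α * a) ≡ suc c * α * S * a
    r₂ = solve-∀
  found : ∃ λ j → j ∈ allFin S ×
            c * β * S * ∑ (A′ j) e + α * length A ≤ suc c * α * S * length (A′ j)
  found = ∑-≤⇒∃ (allFin S) (subst (0 <_) (sym (length-allFin S)) S>0) total
  j = proj₁ found
  bound = proj₂ (proj₂ found)
  cost : c * β * ∑ (A′ j) e ≤ suc c * α * length (A′ j)
  cost = *-cancelʳ-≤ _ _ S {{>-nonZero S>0}} (begin
    c * β * ∑ (A′ j) e * S           ≡⟨ r (c * β) (∑ (A′ j) e) S ⟩
    c * β * S * ∑ (A′ j) e           ≤⟨ m+n≤o⇒m≤o _ bound ⟩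
    suc c * α * S * length (A′ j)    ≡⟨ r (suc c * α) (length (A′ j)) S ⟨
    suc c * α * length (A′ j) * S    ∎)
    where
    open ≤-Reasoning
    r : ∀ a b c → a * b * c ≡ a * c * b
    r = solve-∀
  large : length A ≤ suc c * S * length (A′ j)
  large = *-cancelˡ-≤ α {{>-nonZero α>0}} (begin
    α * length A                      ≤⟨ m+n≤o⇒n≤o _ bound ⟩
    suc c * α * S * length (A′ j)     ≡⟨ r c α S (length (A′ j)) ⟩
    α * (suc c * S * length (A′ j))   ∎)
    where
    open ≤-Reasoning
    r : ∀ c α S a → suc c * α * S * a ≡ α * (suc c * S * a)
    r = solve-∀

DenseSet-filterᵇ : ∀ {Q m N} (A : List (Vec (Fin m) N)) b → DenseSet P A →
  length A ≤ Q * length (filterᵇ b A) → DenseSet (P * Q) (filterᵇ b A)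
DenseSet-filterᵇ {P} {Q} {m} {N} A b (denseSet sub ne d) le = denseSet
  (λ h → ≤-trans (∑-filterᵇ-≤ b A h) (sub h))
  (n≢0⇒n>0 λ eq → <⇒≢ (≤-trans ne le) (sym (trans (cong (Q *_) eq) (*-zeroʳ Q))))
  (begin
    m ^ N                            ≤⟨ d ⟩
    P * length A                     ≤⟨ *-monoʳ-≤ P le ⟩
    P * (Q * length (filterᵇ b A))   ≡⟨ *-assoc P Q _ ⟨
    P * Q * length (filterᵇ b A)     ∎)
  where open ≤-Reasoning

-- Fixing a transcript of one pass leaves a product of dense sets on which the memory ends in one
-- state. The fraction `a / b`, with denominators cleared, bounds the mean of `e` there.
record PassOutcome (T : Trans S N ms) (R : Rect N ms) (st : Fin S) (P : ℕ)
                   (a b : ℕ) (e : Inputs N ms → ℕ) : Set where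
  constructor passOutcome
  field
    R′    : Rect N ms
    st′   : Fin S
    dense : Dense P R′
    sub   : ∀ {x} → x ∈ points R′ → x ∈ points R
    reach : ∀ {x} → x ∈ points R′ → runTrans T x st ≡ st′
    cost  : b * ∑ (points R′) e ≤ a * length (points R′)

∈-filterᵇ-product : (b : X → Bool) (A : List X) (L : List Y) {z : X × Y} →
  z ∈ cartesianProduct (filterᵇ b A) L → (proj₁ z ∈ A × b (proj₁ z) ≡ true) × proj₂ z ∈ L
∈-filterᵇ-product b A L z∈ with ∈-cartesianProduct⁻ (filterᵇ b A) L z∈
... | p , q = ∈-filterᵇ b A p , q

-- The deeper layers were read earlier and, confined to `R′`, lead to the single state `st′`. So the
-- message after this layer is a function of `f` alone, and keeping the inputs with a popular
-- message filters `A` and preserves the product. The bound on the mean grows by the factor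
-- `c₁ / c`.
pass-layer : ∀ {N m ms S P Q} (t : Vec (Fin m) N → Fin S → Fin S) (T : Trans S (N * m) ms)
  (A : List (Vec (Fin m) N)) (R : Rect (N * m) ms) (st : Fin S) c c₁ k α β
  (e : Inputs N (m ∷ ms) → ℕ) → c₁ ≡ suc c → c₁ ≤ k → 0 < S → 0 < α → k * S ≤ Q →
  DenseSet P A →
  PassOutcome T R st (P * Q) (k * (α * length A)) (c₁ * β) (λ x → ∑ A (λ f → e (f , x))) →
  PassOutcome {ms = m ∷ ms} (t , T) (A , R) st (P * Q) (k * α) (c * β) e
pass-layer {N} {m} {ms} {S} {P} {Q} t T A R st c c₁ k α β e c₁≡ c₁≤k S>0 α>0 Q≥ dA rec =
  passOutcome (A′ , R′) j (dA′ , D′) sub′ reach′ cost′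
  where
  open PassOutcome rec using (R′; st′; sub; reach) renaming (dense to D′; cost to cost₁)
  e″ : Vec (Fin m) N → ℕ
  e″ f = ∑ (points R′) (λ x → e (f , x))
  r = length (points R′)
  k>0 : 0 < k
  k>0 = ≤-trans (subst (0 <_) (sym c₁≡) z<s) c₁≤k
  α₁ = k * α * r
  hyp″ : c₁ * β * ∑ A e″ ≤ α₁ * length A
  hyp″ = begin
    c₁ * β * ∑ A e″               ≡⟨ cong (c₁ * β *_) (∑-swap A (points R′) _) ⟩
    c₁ * β * _                    ≤⟨ cost₁ ⟩
    k * (α * length A) * r        ≡⟨ rr k α (length A) r ⟩
    α₁ * length A ∎
    where
    open ≤-Reasoning
    rr : ∀ a b c d → a * (b * c) * d ≡ a * b * d * c
    rr = solve-∀
  found = popular-message A (λ f → t f st′) e″ c c₁ α₁ (c₁ * β) c₁≡ S>0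
            (*-mono-≤ (*-mono-≤ k>0 α>0) (points-nonempty R′ D′)) (nonempty dA) hyp″
  j = proj₁ found
  A′ = filterᵇ (λ f → t f st′ == j) A
  dA′ : DenseSet (P * Q) A′
  dA′ = DenseSet-filterᵇ A _ dA (≤-trans (proj₂ (proj₂ found)) (*-monoˡ-≤ (length A′)
          (≤-trans (*-monoˡ-≤ S c₁≤k) Q≥)))
  split : ∀ {x} → x ∈ cartesianProduct A′ (points R′) →
          (proj₁ x ∈ A × (t (proj₁ x) st′ == j) ≡ true) × proj₂ x ∈ points R′
  split = ∈-filterᵇ-product (λ f → t f st′ == j) A (points R′)
  sub′ : ∀ {x} → x ∈ cartesianProduct A′ (points R′) → x ∈ cartesianProduct A (points R)
  sub′ x∈ = ∈-cartesianProduct⁺ (proj₁ (proj₁ (split x∈))) (sub (proj₂ (split x∈)))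
  reach′ : ∀ {x} → x ∈ cartesianProduct A′ (points R′) → runTrans {ms = m ∷ ms} (t , T) x st ≡ j
  reach′ {x} x∈ = trans (cong (t (proj₁ x)) (reach (proj₂ (split x∈))))
                        (==⇒≡ _ _ (proj₂ (proj₁ (split x∈))))
  instance
    c₁≢0 : NonZero c₁
    c₁≢0 = subst NonZero (sym c₁≡) _
  cost′ : c * β * ∑ (points {N} {m ∷ ms} (A′ , R′)) e ≤
          k * α * length (points {N} {m ∷ ms} (A′ , R′))
  cost′ = *-cancelˡ-≤ c₁ (begin
    c₁ * (c * β * ∑ (points {N} {m ∷ ms} (A′ , R′)) e)
      ≡⟨ cong (λ z → c₁ * (c * β * z)) (∑-points-∷ A′ R′ e) ⟩
    c₁ * (c * β * ∑ A′ e″)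
      ≡⟨ r₁ c₁ c β (∑ A′ e″) ⟩
    c * (c₁ * β) * ∑ A′ e″
      ≤⟨ proj₁ (proj₂ found) ⟩
    c₁ * α₁ * length A′
      ≡⟨ r₂ c₁ k α r (length A′) ⟩
    c₁ * (k * α * (length A′ * r))
      ≡⟨ cong (λ w → c₁ * (k * α * w)) (length-points-∷ A′ R′) ⟨
    c₁ * (k * α * length (points {N} {m ∷ ms} (A′ , R′))) ∎)
    where
    open ≤-Reasoning
    r₁ : ∀ c₁ c β E → c₁ * (c * β * E) ≡ c * (c₁ * β) * E
    r₁ = solve-∀
    r₂ : ∀ s a α r l → s * (a * α * r) * l ≡ s * (a * α * (l * r))
    r₂ = solve-∀

-- The losses `(c + 1) / c` of the single layers telescope to `k / c`. This is at most 2 when there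
-- are at most `c` layers, whereas a constant factor for each layer would multiply up.
pass : ∀ ms {N S P Q} (T : Trans S N ms) (R : Rect N ms) (st : Fin S) c k α β e →
  c + length ms ≡ k → 0 < S → 0 < α → k * S ≤ Q → Dense P R →
  β * ∑ (points R) e ≤ α * length (points R) →
  PassOutcome T R st (P * Q) (k * α) (c * β) e
pass [] {N} T R st c k α β e c+ℓ≡k S>0 α>0 Q≥ D hyp =
  passOutcome R st tt id (λ _ → refl) (begin
    c * β * ∑ (points {N} {[]} R) e    ≡⟨ *-assoc c β _ ⟩
    c * (β * ∑ (points {N} {[]} R) e)  ≤⟨ *-monoʳ-≤ c hyp ⟩
    c * (α * 1)               ≡⟨ *-assoc c α 1 ⟨
    c * α * 1                 ≡⟨ cong (λ z → z * α * 1) (trans (sym (+-identityʳ c)) c+ℓ≡k) ⟩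
    k * α * 1 ∎)
  where open ≤-Reasoning
pass (m ∷ ms) {N} {S} {P} {Q} (t , T) (A , R) st c k α β e c+ℓ≡k S>0 α>0 Q≥ (dA , D) hyp =
  pass-layer t T A R st c (suc c) k α β e refl (≤-trans (m≤m+n (suc c) (length ms)) (≤-reflexive 1+c+ℓ≡k))
    S>0 α>0 Q≥ dA
    (pass ms T R st (suc c) k (α * length A) β _ 1+c+ℓ≡k S>0 (*-mono-≤ α>0 (nonempty dA)) Q≥ D hyp′)
  where
  1+c+ℓ≡k : suc c + length ms ≡ k
  1+c+ℓ≡k = trans (sym (+-suc c (length ms))) c+ℓ≡k
  hyp′ : β * ∑ (points R) (λ x → ∑ A (λ f → e (f , x))) ≤ α * length A * length (points R)
  hyp′ = begin
    β * ∑ (points R) (λ x → ∑ A (λ f → e (f , x)))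
      ≡⟨ cong (β *_) (trans (∑-points-∷ A R e) (∑-swap A (points R) _)) ⟨
    β * ∑ (points {N} {m ∷ ms} (A , R)) e
      ≤⟨ hyp ⟩
    α * length (points {N} {m ∷ ms} (A , R))
      ≡⟨ trans (cong (α *_) (length-points-∷ A R)) (sym (*-assoc α _ _)) ⟩
    α * length A * length (points R) ∎
    where open ≤-Reasoning

-- Walking down the tree: passes, pointers and balanced children

size : ℕ → List ℕ → ℕ
size N []       = N
size N (m ∷ ms) = size (N * m) ms

follow : Fin N → Inputs N ms → Fin (size N ms)
follow {ms = []}     v _       = v
follow {ms = m ∷ ms} v (f , x) = follow (combine v (lookup f v)) x

-- A pass over the stream; once the upper layers of the input are fixed, they act on
-- the memory as the function post.
record Pass (S N : ℕ) (ms : List ℕ) : Set where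
  constructor mkPass
  field
    transitions : Trans S N ms
    post   : Fin S → Fin S

open Pass

runPass : Pass S N ms → Inputs N ms → Fin S → Fin S
runPass p x st = post p (runTrans (transitions p) x st)

-- The top layer is read last among the layers, so once its pointers are fixed its effect joins
-- `post`.
fixLayer : Vec (Fin m) N → Pass S N (m ∷ ms) → Pass S (N * m) ms
fixLayer f p = mkPass (proj₂ (transitions p)) (post p ∘ proj₁ (transitions p) f)

runAll : ℕ → (ℕ → Pass S N ms) → Inputs N ms → Fin S → Fin S
runAll zero    p x st = st
runAll (suc r) p x st = runAll r (p ∘ suc) x (runPass (p 0) x st)

runAll-fixLayer : ∀ r (p : ℕ → Pass S N (m ∷ ms)) f x st →
  runAll r (fixLayer f ∘ p) x st ≡ runAll r p (f , x) st
runAll-fixLayer zero    p f x st = refl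
runAll-fixLayer (suc r) p f x st = runAll-fixLayer r (p ∘ suc) f x _

not-true⇒false : ∀ {b} → not b ≡ true → b ≡ false
not-true⇒false {false} _ = refl

∧-true : ∀ {a b} → a ∧ b ≡ true → a ≡ true × b ≡ true
∧-true {true} e = refl , e

-- Fewer than half of the values at `v` are light, and by Markov at most a quarter carry more than 4
-- times their share of the cost bound. At least a quarter of the values, hence `8 * q`, avoid both.
-- The fibre of such a value has a share of at least `1 / (8 * m)`, so the mean cost in it is at
-- most `8 * 4 = 32` times the bound, and some `f` in it costs no more.
pointer-candidates : ∀ {m N} (A : List (Vec (Fin m) N)) (v : Fin N) (e : Vec (Fin m) N → ℕ) α β q →
  0 < length A → Balanced A v → 0 < α → β * ∑ A e ≤ α * length A → 32 * q ≤ m →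
  ∃ λ J → count {m} J ≡ 8 * q ×
    (∀ y → J y ≡ true → ∃ λ f → f ∈ A × lookup f v ≡ y × β * e f ≤ 32 * α)
pointer-candidates {m} {N} A v e α β q A>0 bal α>0 hyp m≥ =
  J , |J| , λ y Jy → choose y (J⊆ y Jy)
  where
  E : Fin m → ℕ
  E y = ∑ (fibre A v y) e
  w : Fin m → ℕ
  w y = length (fibre A v y)
  cheap cand : Fin m → Bool
  cheap y = m * (β * E y) ≤ᵇ 4 * (α * length A)
  cand y = not (light A v y) ∧ cheap y

  expensive-≥ : ∀ y → 𝟙 (not (cheap y)) * (4 * (α * length A)) ≤ m * (β * E y)
  expensive-≥ y with cheap y in eq
  ... | true  = z≤n
  ... | false = ≤-trans (≤-reflexive (*-identityˡ _)) (<⇒≤ (≰⇒> λ le → subst T eq (≤⇒≤ᵇ le)))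

  expensive : 4 * count (not ∘ cheap) ≤ m
  expensive = *-cancelʳ-≤ _ _ (α * length A) {{>-nonZero (*-mono-≤ α>0 A>0)}} (begin
    4 * count (not ∘ cheap) * (α * length A)
      ≡⟨ r (count (not ∘ cheap)) (α * length A) ⟩
    count (not ∘ cheap) * (4 * (α * length A))
      ≡⟨ ∑-*ʳ (allFin m) (𝟙 ∘ not ∘ cheap) _ ⟨
    ∑ (allFin m) (λ y → 𝟙 (not (cheap y)) * (4 * (α * length A)))
      ≤⟨ ∑-mono (allFin m) expensive-≥ ⟩
    ∑ (allFin m) (λ y → m * (β * E y))
      ≡⟨ trans (∑-*ˡ (allFin m) m _) (cong (m *_) (trans (∑-*ˡ (allFin m) β E)
           (cong (β *_) (∑-fibres (λ x → lookup x v) A e)))) ⟩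
    m * (β * ∑ A e)
      ≤⟨ *-monoʳ-≤ m hyp ⟩
    m * (α * length A) ∎)
    where
    open ≤-Reasoning
    r : ∀ a b → 4 * a * b ≡ a * (4 * b)
    r = solve-∀

  cover : m ≤ count cand + (count (light A v) + count (not ∘ cheap))
  cover = begin
    m                                ≡⟨ trans (∑-allFin-const m 1) (*-identityʳ m) ⟨
    ∑ (allFin m) (λ _ → 1)           ≤⟨ ∑-mono (allFin m) (λ y → one (light A v y) (cheap y)) ⟩
    ∑ (allFin m) (λ y → 𝟙 (cand y) + (𝟙 (light A v y) + 𝟙 (not (cheap y))))
      ≡⟨ trans (∑-+ (allFin m) _ _) (cong (count cand +_) (∑-+ (allFin m) _ _)) ⟩
    count cand + (count (light A v) + count (not ∘ cheap)) ∎
    where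
    open ≤-Reasoning
    one : ∀ a b → 1 ≤ 𝟙 (not a ∧ b) + (𝟙 a + 𝟙 (not b))
    one true  b     = s≤s z≤n
    one false true  = s≤s z≤n
    one false false = s≤s z≤n

  many : 8 * q ≤ count cand
  many = *-cancelˡ-≤ 4 (≤-trans (≤-reflexive (sym (*-assoc 4 8 q))) (≤-trans m≥
    (+-cancelʳ-≤ (m + m + m) _ _ (begin
      m + (m + m + m)
        ≡⟨ r₁ m ⟩
      4 * m
        ≤⟨ *-monoʳ-≤ 4 cover ⟩
      4 * (count cand + (count (light A v) + count (not ∘ cheap)))
        ≡⟨ r₂ (count cand) (count (light A v)) (count (not ∘ cheap)) ⟩
      4 * count cand + (2 * count (light A v) + 2 * count (light A v) + 4 * count (not ∘ cheap))
        ≤⟨ +-monoʳ-≤ (4 * count cand) (+-mono-≤ (+-mono-≤ (<⇒≤ bal) (<⇒≤ bal)) expensive) ⟩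
      4 * count cand + (m + m + m) ∎))))
    where
    open ≤-Reasoning
    r₁ : ∀ m → m + (m + m + m) ≡ 4 * m
    r₁ = solve-∀
    r₂ : ∀ a b c → 4 * (a + (b + c)) ≡ 4 * a + (2 * b + 2 * b + 4 * c)
    r₂ = solve-∀

  thin = shrink cand (8 * q) many
  J = proj₁ thin
  J⊆ = proj₁ (proj₂ thin)
  |J| = proj₂ (proj₂ thin)

  choose : ∀ y → cand y ≡ true → ∃ λ f → f ∈ A × lookup f v ≡ y × β * e f ≤ 32 * α
  choose y cy = f , proj₁ f∈A , ==⇒≡ _ _ (proj₂ f∈A) , proj₂ (proj₂ found)
    where
    heavy : length A ≤ 8 * m * w y
    heavy = heavy-≥ A v y (not-true⇒false (proj₁ (∧-true cy)))
    low : m * (β * E y) ≤ 4 * (α * length A)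
    low = ≤ᵇ⇒≤ _ _ (subst T (sym (proj₂ (∧-true {not (light A v y)} cy))) _)
    w>0 : 0 < w y
    w>0 = n≢0⇒n>0 λ eq → <⇒≢ (≤-trans A>0 heavy) (sym (trans (cong (8 * m *_) eq) (*-zeroʳ (8 * m))))
    mean : β * E y ≤ 32 * α * w y
    mean = *-cancelˡ-≤ m {{Fin.nonZeroIndex y}} (begin
      m * (β * E y)             ≤⟨ low ⟩
      4 * (α * length A)        ≤⟨ *-monoʳ-≤ 4 (*-monoʳ-≤ α heavy) ⟩
      4 * (α * (8 * m * w y))   ≡⟨ r α m (w y) ⟩
      m * (32 * α * w y) ∎)
      where
      open ≤-Reasoning
      r : ∀ a m w → 4 * (a * (8 * m * w)) ≡ m * (32 * a * w)
      r = solve-∀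
    found = ∑-≤⇒∃ (fibre A v y) {λ f → β * e f} {λ _ → 32 * α} w>0 (begin
      ∑ (fibre A v y) (λ f → β * e f)     ≡⟨ ∑-*ˡ (fibre A v y) β e ⟩
      β * E y                             ≤⟨ mean ⟩
      32 * α * w y                        ≡⟨ *-comm (32 * α) (w y) ⟩
      w y * (32 * α)                      ≡⟨ ∑-const (fibre A v y) _ ⟨
      ∑ (fibre A v y) (λ _ → 32 * α) ∎)
      where open ≤-Reasoning
    f = proj₁ found
    f∈A = ∈-filterᵇ (λ x → lookup x v == y) A (proj₁ (proj₂ found))

-- The candidates `J` single out `8 * q` children of `v`, which are coordinates of the next layer,
-- with indicator `J′`. By `dense⇒balanced` they cannot all be unbalanced.
balanced-child : ∀ {m N m′} (A : List (Vec (Fin m′) (N * m))) P q (v : Fin N) (J : Fin m → Bool) →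
  DenseSet P A → P < 8 ^ q → count J ≡ 8 * q →
  ∃ λ y → J y ≡ true × Balanced A (combine v y)
balanced-child {m} {N} A P q v J d P< |J| with Fin.any? (λ y → dec y)
  where
  dec : ∀ y → Dec (J y ≡ true × Balanced A (combine v y))
  dec y = (J y Bool.≟ true) ×-dec balanced? A (combine v y)
... | yes p = p
... | no ¬p = ⊥-elim (dense⇒balanced A P q J′ (⊑all d) (nonempty d) (dense d) P< (trans |J′| |J|)
    λ i Ji bal → ¬p (proj₂ (remQuot′ i) , proj₂ (∧-true {v == proj₁ (remQuot′ i)} Ji) , subst (Balanced A) (i≡ i Ji) bal))
  where
  remQuot′ : Fin (N * m) → Fin N × Fin m
  remQuot′ = Fin.remQuot {N} m
  J′ : Fin (N * m) → Bool
  J′ i = (v == proj₁ (remQuot′ i)) ∧ J (proj₂ (remQuot′ i))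
  i≡ : ∀ i → J′ i ≡ true → i ≡ combine v (proj₂ (remQuot′ i))
  i≡ i Ji = trans (sym (Fin.combine-remQuot {N} m i))
    (cong (λ u → combine u (proj₂ (remQuot′ i))) (sym (==⇒≡ v (proj₁ (remQuot′ i)) (proj₁ (∧-true Ji)))))
  𝟙-∧ : ∀ a b → 𝟙 (a ∧ b) ≡ 𝟙 a * 𝟙 b
  𝟙-∧ true  b = sym (*-identityˡ (𝟙 b))
  𝟙-∧ false b = refl
  |J′| : count J′ ≡ count J
  |J′| = begin
    count J′
      ≡⟨ ∑-combine N m (𝟙 ∘ J′) ⟩
    ∑ (allFin N) (λ u → ∑ (allFin m) (λ y → 𝟙 (J′ (combine u y))))
      ≡⟨ ∑-cong (allFin N) (λ u → ∑-cong (allFin m) (λ y →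
           trans (cong (λ z → 𝟙 ((v == proj₁ z) ∧ J (proj₂ z))) (Fin.remQuot-combine u y))
                 (𝟙-∧ (v == u) (J y)))) ⟩
    ∑ (allFin N) (λ u → ∑ (allFin m) (λ y → 𝟙 (v == u) * 𝟙 (J y)))
      ≡⟨ ∑-cong (allFin N) (λ u → ∑-*ˡ (allFin m) (𝟙 (v == u)) _) ⟩
    ∑ (allFin N) (λ u → 𝟙 (v == u) * count J)
      ≡⟨ ∑-δ v (λ _ → count J) ⟩
    count J ∎
    where open ≡-Reasoning

-- The adversary

-- The arity `32 * q` is what `pointer-candidates` needs to offer `8 * q` children.
Bushy : ℕ → ℕ → List ℕ → Set
Bushy q m []        = m ≡ 2
Bushy q m (m′ ∷ ms) = 32 * q ≤ m × Bushy q m′ ms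

count-zero : ∀ {n} (b : Fin n → Bool) → count b ≡ 0 → ∀ i → b i ≡ false
count-zero b eq i with b i in bi
... | false = refl
... | true  = ⊥-elim (<⇒≱ (subst (λ z → 𝟙 z ≤ count b) bi (∈-≤-∑ (∈-allFin i) (𝟙 ∘ b))) (≤-reflexive eq))

-- A balanced binary coordinate has no light value, so each value has a share of at least
-- `1 / (8 * 2)`. A value with weight at least `H` alone brings the mean up to `H / 16`.
leaf-level : ∀ {N} (A : List (Vec (Fin 2) N)) (v : Fin N) (g : Fin 2 → ℕ) (e : Vec (Fin 2) N → ℕ) H α β →
  0 < length A → Balanced A v → (∀ {f} → f ∈ A → e f ≡ g (lookup f v)) →
  (∃ λ y → H ≤ g y) → β * ∑ A e ≤ α * length A → β * H ≤ 16 * α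
leaf-level A v g e H α β A>0 bal e≡ (y , H≤) hyp = *-cancelʳ-≤ _ _ (length A) {{>-nonZero A>0}} (begin
  β * H * length A
    ≤⟨ *-monoʳ-≤ (β * H) (heavy-≥ A v y (count-zero (light A v) none y)) ⟩
  β * H * (16 * length (fibre A v y))
    ≡⟨ r₁ β H (length (fibre A v y)) ⟩
  16 * (β * (length (fibre A v y) * H))
    ≤⟨ *-monoʳ-≤ 16 (*-monoʳ-≤ β (≤-trans (*-monoʳ-≤ (length (fibre A v y)) H≤) mass)) ⟩
  16 * (β * ∑ A e)
    ≤⟨ *-monoʳ-≤ 16 hyp ⟩
  16 * (α * length A)
    ≡⟨ *-assoc 16 α (length A) ⟨
  16 * α * length A ∎)
  where
  open ≤-Reasoning
  r₁ : ∀ b h l → b * h * (16 * l) ≡ 16 * (b * (l * h))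
  r₁ = solve-∀
  none : count (light A v) ≡ 0
  none = n<1⇒n≡0 (*-cancelˡ-< 2 _ _ bal)
  mass : length (fibre A v y) * g y ≤ ∑ A e
  mass = begin
    length (fibre A v y) * g y        ≡⟨ ∑-const (fibre A v y) _ ⟨
    ∑ (fibre A v y) (λ _ → g y)       ≡⟨ ∑-cong-∈ (fibre A v y) (λ f f∈ → sym (e≡y f∈)) ⟩
    ∑ (fibre A v y) e                 ≤⟨ ∑-filterᵇ-≤ (λ x → lookup x v == y) A e ⟩
    ∑ A e ∎
    where
    e≡y : ∀ {f} → f ∈ fibre A v y → e f ≡ g y
    e≡y f∈ = trans (e≡ (proj₁ (∈-filterᵇ _ A f∈))) (cong g (==⇒≡ _ _ (proj₂ (∈-filterᵇ _ A f∈))))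

record Descent {S N m ms} (p : Pass S N (m ∷ ms)) (A : List (Vec (Fin m) N)) (R : Rect (N * m) ms)
               (v : Fin N) (st : Fin S) (P α β : ℕ) (e : Inputs N (m ∷ ms) → ℕ)
               (child : Rect (N * m) ms → Fin (N * m) → Set) : Set where
  constructor descent
  field
    f     : Vec (Fin m) N
    f∈    : f ∈ A
    R′    : Rect (N * m) ms
    dense : Dense P R′
    bal   : child R′ (combine v (lookup f v))
    st′   : Fin S
    reach : ∀ {x} → x ∈ points R′ → (x ∈ points R) × runPass p (f , x) st ≡ st′
    cost  : β * ∑ (points R′) (λ x → e (f , x)) ≤ 64 * α * length (points R′)

BalancedHead : ∀ {N m ms} → Rect N (m ∷ ms) → Fin N → Set
BalancedHead (A , _) v = Balanced A v

-- The order of the choices matters: first the transcript of the lower layers, then a candidate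
-- child that is balanced in the restricted next layer, and only then `f` with this pointer. The
-- transcript costs a factor 2 and the pointer 32, together 64.
descend : ∀ {S N m m′ ms P Q q c} (p : Pass S N (m ∷ m′ ∷ ms)) (A : List (Vec (Fin m) N))
  (R : Rect (N * m) (m′ ∷ ms)) (v : Fin N) (st : Fin S) α β (e : Inputs N (m ∷ m′ ∷ ms) → ℕ) →
  0 < S → 0 < c → length (m′ ∷ ms) ≤ c → 2 * c * S ≤ Q → P * Q < 8 ^ q → 32 * q ≤ m →
  0 < length A → Balanced A v → Dense P R → 0 < α →
  β * ∑ (points {N} {m ∷ m′ ∷ ms} (A , R)) e ≤ α * length (points {N} {m ∷ m′ ∷ ms} (A , R)) →
  Descent p A R v st (P * Q) α β e BalancedHead
descend {S} {N} {m} {m′} {ms} {P} {Q} {q} {c} p A R v st α β e S>0 c>0 len≤c Q≥ PQ< m≥ A>0 bal D α>0 hyp =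
  descent f (proj₁ f-props) R′ D′
    (subst (BalancedHead R′ ∘ combine v) (sym (proj₁ (proj₂ f-props))) (proj₂ (proj₂ child)))
    (post p (proj₁ (transitions p) f st′))
    (λ x∈ → sub x∈ , cong (λ z → post p (proj₁ (transitions p) f z)) (reach x∈))
    (≤-trans (proj₂ (proj₂ f-props)) (≤-reflexive (r₃ α (length (points R′)))))
  where
  open ≤-Reasoning
  r₃ : ∀ α r → 32 * (2 * α * r) ≡ 64 * α * r
  r₃ = solve-∀
  -- While the lower layers are restricted the top layer is still open, so the mean runs over all of
  -- `A`.
  e₁ : Inputs (N * m) (m′ ∷ ms) → ℕ
  e₁ x = ∑ A (λ f → e (f , x))
  k = c + length (m′ ∷ ms)
  k≤2c : k ≤ 2 * c
  k≤2c = ≤-trans (+-monoʳ-≤ c len≤c) (≤-reflexive (cong (c +_) (sym (+-identityʳ c))))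
  hyp₁ : β * ∑ (points R) e₁ ≤ α * length A * length (points R)
  hyp₁ = begin
    β * ∑ (points R) e₁
      ≡⟨ cong (β *_) (trans (∑-points-∷ A R e) (∑-swap A (points R) _)) ⟨
    β * ∑ (points {N} {m ∷ m′ ∷ ms} (A , R)) e
      ≤⟨ hyp ⟩
    α * length (points {N} {m ∷ m′ ∷ ms} (A , R))
      ≡⟨ trans (cong (α *_) (length-points-∷ A R)) (sym (*-assoc α _ _)) ⟩
    α * length A * length (points R) ∎
  out : PassOutcome (proj₂ (transitions p)) R st (P * Q) (k * (α * length A)) (c * β) e₁
  out = pass (m′ ∷ ms) (proj₂ (transitions p)) R st c k (α * length A) β e₁ refl S>0
          (*-mono-≤ α>0 A>0) (≤-trans (*-monoˡ-≤ S k≤2c) Q≥) D hyp₁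
  open PassOutcome out using (R′; st′; sub; reach) renaming (dense to D′; cost to cost₁)
  e₂ : Vec (Fin m) N → ℕ
  e₂ f = ∑ (points R′) (λ x → e (f , x))
  α₁ = 2 * α * length (points R′)
  hyp₂ : β * ∑ A e₂ ≤ α₁ * length A
  hyp₂ = *-cancelˡ-≤ c {{>-nonZero c>0}} (begin
    c * (β * ∑ A e₂)
      ≡⟨ cong (λ z → c * (β * z)) (∑-swap A (points R′) _) ⟩
    c * (β * ∑ (points R′) e₁)
      ≡⟨ *-assoc c β _ ⟨
    c * β * ∑ (points R′) e₁
      ≤⟨ cost₁ ⟩
    k * (α * length A) * length (points R′)
      ≤⟨ *-monoˡ-≤ (length (points R′)) (*-monoˡ-≤ (α * length A) k≤2c) ⟩
    2 * c * (α * length A) * length (points R′)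
      ≡⟨ r c α (length A) (length (points R′)) ⟩
    c * (α₁ * length A) ∎)
    where
    r : ∀ c a l r → 2 * c * (a * l) * r ≡ c * (2 * a * r * l)
    r = solve-∀
  cands = pointer-candidates A v e₂ α₁ β q A>0 bal (*-mono-≤ {1} {2 * α} (*-mono-≤ {1} {2} (s≤s z≤n) α>0) (points-nonempty R′ D′)) hyp₂ m≥
  child : ∃ λ y → proj₁ cands y ≡ true × BalancedHead R′ (combine v y)
  child = balanced-child (proj₁ R′) (P * Q) q v (proj₁ cands) (proj₁ D′) PQ< (proj₁ (proj₂ cands))
  chosen = proj₂ (proj₂ cands) (proj₁ child) (proj₁ (proj₂ child))
  f = proj₁ chosen
  f-props = proj₂ chosen

-- Each pass settles one pointer, so `length ms` passes end at a balanced node above the binary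
-- level, with the memory constant on what remains. By `sep` this one state has weight at least `H`
-- at one of the two leaves, which by `leaf-level` forces a mean of at least `H / 16`; each pass has
-- raised the bound on the mean by a factor 64.
adversary : ∀ m ms {S N P Q q c} (p : ℕ → Pass S N (m ∷ ms)) (A : List (Vec (Fin m) N))
  (R : Rect (N * m) ms) (v : Fin N) (st : Fin S) (W : Fin S → Fin (size N (m ∷ ms)) → ℕ) H α β
  (e : Inputs N (m ∷ ms) → ℕ) →
  Bushy q m ms → 0 < S → 0 < c → length ms ≤ c → 2 * c * S ≤ Q → P * Q ^ length ms < 8 ^ q →
  0 < length A → Balanced A v → Dense P R → 0 < α →
  β * ∑ (points {N} {m ∷ ms} (A , R)) e ≤ α * length (points {N} {m ∷ ms} (A , R)) →
  (∀ {z} → z ∈ points {N} {m ∷ ms} (A , R) →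
     e z ≡ W (runAll (length ms) p z st) (follow {ms = m ∷ ms} v z)) →
  (∀ st u u′ → u ≢ u′ → H ≤ W st u ⊎ H ≤ W st u′) →
  β * H ≤ 64 ^ length ms * (16 * α)
adversary m [] {S} {N} p A R v st W H α β e refl _ _ _ _ _ A>0 bal _ _ hyp rel sep =
  ≤-trans (leaf-level A v (λ y → W st (combine v y)) (λ f → e (f , tt)) H α β A>0 bal
    (λ f∈ → rel (∈-cartesianProduct⁺ f∈ (here refl))) two
    (subst₂ (λ a b → β * a ≤ α * b)
      (trans (∑-points-∷ {ms = []} A R e) (∑-cong A (λ f → +-identityʳ _)))
      (trans (length-points-∷ {ms = []} A R) (*-identityʳ _)) hyp))
    (≤-reflexive (sym (*-identityˡ (16 * α))))
  where
  two : ∃ λ y → H ≤ W st (combine v y)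
  two with sep st (combine v zero) (combine v (suc zero))
             (λ eq → Fin.0≢1+n (Fin.combine-injectiveʳ v zero v (suc zero) eq))
  ... | inj₁ h = zero , h
  ... | inj₂ h = suc zero , h
adversary m (m′ ∷ ms) {S} {N} {P} {Q} {q} {c} p A R v st W H α β e (m≥ , bushy) S>0 c>0 len≤c Q≥ PQ< A>0 bal D α>0 hyp rel sep =
  ≤-trans
    (adversary m′ ms {q = q} (fixLayer f ∘ p ∘ suc) (proj₁ R′) (proj₂ R′) (combine v (lookup f v)) st′ W H (64 * α) β
      (λ x → e (f , x)) bushy S>0 c>0 (<⇒≤ len≤c) Q≥ (subst (_< 8 ^ q) (sym (*-assoc P Q _)) PQ<)
      (nonempty (proj₁ D′)) bal′ (proj₂ D′) (*-mono-≤ {1} {64} (s≤s z≤n) α>0) cost rel′ sep)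
    (≤-reflexive (r (64 ^ length ms) α))
  where
  r : ∀ x α → x * (16 * (64 * α)) ≡ 64 * x * (16 * α)
  r = solve-∀
  Q>0 : 0 < Q
  Q>0 = ≤-trans (*-mono-≤ (*-mono-≤ {1} {2} (s≤s z≤n) c>0) S>0) Q≥
  P*Q< : P * Q < 8 ^ q
  P*Q< = ≤-<-trans (*-monoʳ-≤ P (≤-trans (≤-reflexive (sym (*-identityʳ Q)))
           (*-monoʳ-≤ Q (m^n>0 Q {{>-nonZero Q>0}} (length ms))))) PQ<
  descended : Descent (p 0) A R v st (P * Q) α β e BalancedHead
  descended = descend {q = q} (p 0) A R v st α β e S>0 c>0 len≤c Q≥ P*Q< m≥ A>0 bal D α>0 hyp
  open Descent descended using (f; f∈; R′; st′; reach; cost) renaming (dense to D′; bal to bal′)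
  rel′ : ∀ {x} → x ∈ points R′ → e (f , x) ≡
    W (runAll (length ms) (fixLayer f ∘ p ∘ suc) x st′) (follow {ms = m′ ∷ ms} (combine v (lookup f v)) x)
  rel′ {x} x∈ = trans (rel (∈-cartesianProduct⁺ f∈ (proj₁ (reach x∈))))
    (cong (λ z → W z (follow {ms = m′ ∷ ms} (combine v (lookup f v)) x))
      (trans (cong (runAll (length ms) (p ∘ suc) (f , x)) (proj₂ (reach x∈)))
             (sym (runAll-fixLayer (length ms) (p ∘ suc) f x st′))))

-- Tournaments from trees

infixl 6 _<F_

_<F_ : ∀ {n} → Fin n → Fin n → Bool
i <F j = toℕ i <ᵇ toℕ j

<ᵇ-true : ∀ {m n} → m < n → (m <ᵇ n) ≡ true
<ᵇ-true {m} {n} lt with m <ᵇ n | <⇒<ᵇ lt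
... | true | _ = refl

<ᵇ-false : ∀ {m n} → ¬ m < n → (m <ᵇ n) ≡ false
<ᵇ-false {m} {n} ¬lt with m <ᵇ n in eq
... | false = refl
... | true  = ⊥-elim (¬lt (<ᵇ⇒< m n (subst T (sym eq) _)))

+-<ᵇ : ∀ k m n → (k + m <ᵇ k + n) ≡ (m <ᵇ n)
+-<ᵇ zero    m n = refl
+-<ᵇ (suc k) m n = +-<ᵇ k m n

-- At one point: the first set is the disjoint union of the other two.
data Splits : Bool → Bool → Bool → Set where
  left  : Splits true  true  false
  right : Splits true  false true
  none  : Splits false false false

filterᵇ-splits : {a b c : X → Bool} → (∀ x → Splits (a x) (b x) (c x)) → (L : List X) →
  filterᵇ a L ↭ filterᵇ c L ++ filterᵇ b L
filterᵇ-splits s [] = ↭-refl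
filterᵇ-splits {a = a} {b} {c} s (x ∷ L) with a x | b x | c x | s x
... | true  | true  | false | left  = ↭-trans (prep x (filterᵇ-splits s L)) (↭-sym (shift x (filterᵇ c L) (filterᵇ b L)))
... | true  | false | true  | right = prep x (filterᵇ-splits s L)
... | false | false | false | none  = filterᵇ-splits s L

-- Only the place of the pointed child matters: it goes last. How the siblings are permuted is
-- arbitrary.
toTop : Fin m → Permutation′ m
toTop {suc n} y = transpose y (fromℕ n)

toTop-top : (y : Fin m) → suc (toℕ (toTop y ⟨$⟩ʳ y)) ≡ m
toTop-top {suc n} y rewrite dec-true (y Fin.≟ y) refl = cong suc (Fin.toℕ-fromℕ n)

before : Permutation′ N → Fin N → Fin N → Bool
before π u v = (π ⟨$⟩ʳ u) <F (π ⟨$⟩ʳ v)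

digits : Permutation′ N → Vec (Fin m) N → (Fin N × Fin m) ↔ (Fin N × Fin m)
digits π f = mk↔ₛ′
  (λ (w , a) → π ⟨$⟩ʳ w , toTop (lookup f w) ⟨$⟩ʳ a)
  (λ (w , a) → Inverse.from π w , Inverse.from (toTop (lookup f (Inverse.from π w))) a)
  (λ (w , a) → cong₂ _,_ (Inverse.strictlyInverseˡ π w) (Inverse.strictlyInverseˡ (toTop (lookup f (Inverse.from π w))) a))
  (λ (w , a) → trans
    (cong (λ z → z , Inverse.from (toTop (lookup f z)) (toTop (lookup f w) ⟨$⟩ʳ a)) (Inverse.strictlyInverseʳ π w))
    (cong (w ,_) (Inverse.strictlyInverseʳ (toTop (lookup f w)) a)))

extend : Permutation′ N → Vec (Fin m) N → Permutation′ (N * m)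
extend π f = ↔-trans Fin.*↔× (↔-trans (digits π f) (↔-sym Fin.*↔×))

-- Depends on `f` but not on the ranking of the parents. Hence the edges of a layer are determined
-- by the pointers of this layer alone.
siblings : Vec (Fin m) N → Fin (N * m) → Fin (N * m) → Bool
siblings {m} {N} f i j = (parent i == parent j) ∧ (shuffled i <F shuffled j)
  where
  parent : Fin (N * m) → Fin N
  parent = proj₁ ∘ remQuot {N} m
  shuffled : Fin (N * m) → Fin m
  -- Both children are ranked with the pointer of the parent of `i`; the first conjunct makes it the
  -- parent of `j` too.
  shuffled k = toTop (lookup f (parent i)) ⟨$⟩ʳ proj₂ (remQuot {N} m k)

==-false : ∀ {n} {i j : Fin n} → i ≢ j → (i == j) ≡ false
==-false {i = i} {j} ne with i Fin.≟ j
... | yes p = ⊥-elim (ne p)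
... | no _  = refl

-- `combine` orders pairs lexicographically: distinct parents decide the comparison, and equal
-- parents leave it to the shuffled children.
lexicographic : (π : Permutation′ N) (f : Vec (Fin m) N) (w w′ : Fin N) (a a′ : Fin m) →
  Splits (combine (π ⟨$⟩ʳ w) (toTop (lookup f w) ⟨$⟩ʳ a) <F combine (π ⟨$⟩ʳ w′) (toTop (lookup f w′) ⟨$⟩ʳ a′))
         (before π w w′)
         ((w == w′) ∧ ((toTop (lookup f w) ⟨$⟩ʳ a) <F (toTop (lookup f w) ⟨$⟩ʳ a′)))
lexicographic {N} {m} π f w w′ a a′ with <-cmp (toℕ (π ⟨$⟩ʳ w)) (toℕ (π ⟨$⟩ʳ w′))
... | tri< lt ne _
  rewrite <ᵇ-true lt | <ᵇ-true (Fin.combine-monoˡ-< {i = π ⟨$⟩ʳ w} {π ⟨$⟩ʳ w′} (toTop (lookup f w) ⟨$⟩ʳ a) (toTop (lookup f w′) ⟨$⟩ʳ a′) lt)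
        | ==-false {i = w} {w′} (λ { refl → ne refl }) = left
... | tri> ¬lt ne gt
  rewrite <ᵇ-false ¬lt | <ᵇ-false (<⇒≯ (Fin.combine-monoˡ-< {i = π ⟨$⟩ʳ w′} {π ⟨$⟩ʳ w} (toTop (lookup f w′) ⟨$⟩ʳ a′) (toTop (lookup f w) ⟨$⟩ʳ a) gt))
        | ==-false {i = w} {w′} (λ { refl → ne refl }) = none
... | tri≈ ¬lt eq _ with refl ← Injection.injective (↔⇒↣ π) {w} {w′} (Fin.toℕ-injective eq)
  rewrite <ᵇ-false ¬lt | ==-refl w
        | Fin.toℕ-combine (π ⟨$⟩ʳ w) (toTop (lookup f w) ⟨$⟩ʳ a)
        | Fin.toℕ-combine (π ⟨$⟩ʳ w) (toTop (lookup f w) ⟨$⟩ʳ a′)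
        | +-<ᵇ (m * toℕ (π ⟨$⟩ʳ w)) (toℕ (toTop (lookup f w) ⟨$⟩ʳ a)) (toℕ (toTop (lookup f w) ⟨$⟩ʳ a′))
  with (toTop (lookup f w) ⟨$⟩ʳ a) <F (toTop (lookup f w) ⟨$⟩ʳ a′)
... | true  = right
... | false = none

before-extend : (π : Permutation′ N) (f : Vec (Fin m) N) (i j : Fin (N * m)) →
  Splits (before (extend π f) i j) (before π (proj₁ (remQuot m i)) (proj₁ (remQuot m j))) (siblings f i j)
before-extend {N} {m} π f i j = lexicographic π f
  (proj₁ (remQuot {N} m i)) (proj₁ (remQuot {N} m j)) (proj₂ (remQuot {N} m i)) (proj₂ (remQuot {N} m j))

IsTop : Permutation′ N → Fin N → Set
IsTop {N} π v = suc (toℕ (π ⟨$⟩ʳ v)) ≡ N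

extend-top : (π : Permutation′ N) (f : Vec (Fin m) N) (v : Fin N) →
  IsTop π v → IsTop (extend π f) (combine v (lookup f v))
extend-top {N} {m} π f v top = begin
  suc (toℕ (extend π f ⟨$⟩ʳ combine v y))
    ≡⟨ cong (λ (w , a) → suc (toℕ (combine (π ⟨$⟩ʳ w) (toTop (lookup f w) ⟨$⟩ʳ a)))) (Fin.remQuot-combine v y) ⟩
  suc (toℕ (combine (π ⟨$⟩ʳ v) (toTop y ⟨$⟩ʳ y)))      ≡⟨ cong suc (Fin.toℕ-combine (π ⟨$⟩ʳ v) _) ⟩
  suc (m * toℕ (π ⟨$⟩ʳ v) + toℕ (toTop y ⟨$⟩ʳ y))      ≡⟨ +-suc (m * toℕ (π ⟨$⟩ʳ v)) _ ⟨
  m * toℕ (π ⟨$⟩ʳ v) + suc (toℕ (toTop y ⟨$⟩ʳ y))      ≡⟨ cong (m * toℕ (π ⟨$⟩ʳ v) +_) (toTop-top y) ⟩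
  m * toℕ (π ⟨$⟩ʳ v) + m                               ≡⟨ trans (+-comm _ m) (sym (*-suc m (toℕ (π ⟨$⟩ʳ v)))) ⟩
  m * suc (toℕ (π ⟨$⟩ʳ v))                             ≡⟨ cong (m *_) top ⟩
  m * N                                                ≡⟨ *-comm m N ⟩
  N * m ∎
  where
  open ≡-Reasoning
  y = lookup f v

rankFrom : Permutation′ N → Inputs N ms → Permutation′ (size N ms)
rankFrom {ms = []}     π _       = π
rankFrom {ms = m ∷ ms} π (f , x) = rankFrom (extend π f) x

rankFrom-top : (π : Permutation′ N) (x : Inputs N ms) (v : Fin N) →
  IsTop π v → IsTop (rankFrom π x) (follow v x)
rankFrom-top {ms = []}     π x       v top = top
rankFrom-top {ms = m ∷ ms} π (f , x) v top =
  rankFrom-top {ms = ms} (extend π f) x (combine v (lookup f v)) (extend-top π f v top)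

-- Sorting the edges into layers

ancestor : ∀ ms → Fin (size N ms) → Fin N
ancestor []           u = u
ancestor {N} (m ∷ ms) u = proj₁ (remQuot {N} m (ancestor ms u))

-- Edges are seen through a view because some vertices are padding and not leaves of the tree.
record View (E : Set) (n : ℕ) : Set where
  field
    view   : (Fin n → Fin n → Bool) → E → Bool
    splits : ∀ {a b c} → (∀ u v → Splits (a u v) (b u v) (c u v)) →
             ∀ e → Splits (view a e) (view b e) (view c e)

open View

-- The edges between leaves whose paths separate at a node of this layer.
layer : ∀ ms {E : Set} → View E (size (N * m) ms) → List E → Vec (Fin m) N → List E
layer ms V L f = filterᵇ (view V (λ u v → siblings f (ancestor ms u) (ancestor ms v))) L

layers : ∀ ms {E : Set} → View E (size N ms) → List E → Inputs N ms → List E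
layers []       V L _       = []
layers (m ∷ ms) V L (f , x) = layers ms V L x ++ layer ms V L f

-- The remainder holds the edges between leaves below different roots. In the induction the
-- remainder for the deeper forest splits into the siblings, which form the next layer, and the
-- pairs with different roots.
layers-↭ : ∀ ms {E : Set} (V : View E (size N ms)) (L : List E) (π : Permutation′ N) (x : Inputs N ms) →
  filterᵇ (view V (before (rankFrom π x))) L ↭
  layers ms V L x ++ filterᵇ (view V (λ u v → before π (ancestor ms u) (ancestor ms v))) L
layers-↭ []       V L π x       = ↭-refl
layers-↭ (m ∷ ms) V L π (f , x) = begin
  filterᵇ (view V (before (rankFrom (extend π f) x))) L
    ↭⟨ layers-↭ ms V L (extend π f) x ⟩
  layers ms V L x ++ filterᵇ (view V (λ u v → before (extend π f) (ancestor ms u) (ancestor ms v))) L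
    ↭⟨ ++⁺ˡ (layers ms V L x) (filterᵇ-splits
         (splits V (λ u v → before-extend π f (ancestor ms u) (ancestor ms v))) L) ⟩
  layers ms V L x ++ layer ms V L f ++ filterᵇ (view V (λ u v → before π (ancestor (m ∷ ms) u) (ancestor (m ∷ ms) v))) L
    ≡⟨ ++-assoc (layers ms V L x) (layer ms V L f) _ ⟨
  (layers ms V L x ++ layer ms V L f) ++ filterᵇ (view V (λ u v → before π (ancestor (m ∷ ms) u) (ancestor (m ∷ ms) v))) L ∎
  where
  open PermutationReasoning

-- The edge list and the padding vertices

filter≡filterᵇ : ∀ {p} {Q : Pred X p} (Q? : Decidable Q) (b : X → Bool) (L : List X) →
  (∀ x → does (Q? x) ≡ b x) → filter Q? L ≡ filterᵇ b L
filter≡filterᵇ Q? b []      e = refl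
filter≡filterᵇ Q? b (x ∷ L) e with does (Q? x) | b x | e x
... | true  | true  | _ = cong (x ∷_) (filter≡filterᵇ Q? b L e)
... | false | false | _ = filter≡filterᵇ Q? b L e

map-filterᵇ : (h : X → Y) (b : Y → Bool) (L : List X) →
  map h (filterᵇ (b ∘ h) L) ≡ filterᵇ b (map h L)
map-filterᵇ h b []      = refl
map-filterᵇ h b (x ∷ L) with b (h x)
... | true  = cong (h x ∷_) (map-filterᵇ h b L)
... | false = map-filterᵇ h b L

allEdges : ∀ n → List (Edge n)
allEdges n = cartesianProduct (allFin n) (allFin n)

edgeList≡ : ∀ {n} (ρ : Permutation′ n) →
  edgeList ρ ≡ filterᵇ (λ (u , v) → before ρ u v) (allEdges n)
edgeList≡ {n} ρ = go (allFin n)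
  where
  b : Edge n → Bool
  b (u , v) = before ρ u v
  out : Fin n → List (Edge n)
  out u = map (u ,_) (filter (λ v → toℕ (ρ ⟨$⟩ʳ u) <? toℕ (ρ ⟨$⟩ʳ v)) (allFin n))
  go : ∀ us → concatMap out us ≡ filterᵇ b (cartesianProduct us (allFin n))
  go []       = refl
  go (u ∷ us) = trans
    (cong₂ _++_ (trans (cong (map (u ,_)) (filter≡filterᵇ _ (λ v → b (u , v)) (allFin n) (λ v → refl)))
                       (map-filterᵇ (u ,_) b (allFin n)))
                (go us))
    (sym (filter-++ _ (map (u ,_) (allFin n)) _))

-- The k additional vertices rank below all leaves.
padRank : ∀ k → Permutation′ N → Permutation′ (k + N)
padRank k π = ↔-trans Fin.+↔⊎ (↔-trans (↔-refl ⊎-↔ π) (↔-sym Fin.+↔⊎))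

padRank-top : ∀ k (π : Permutation′ N) v → IsTop π v → IsTop (padRank k π) (k ↑ʳ v)
padRank-top {N} k π v top rewrite Fin.splitAt-↑ʳ k N v =
  trans (cong suc (Fin.toℕ-↑ʳ k (π ⟨$⟩ʳ v))) (trans (sym (+-suc k _)) (cong (k +_) top))

padView : ∀ k N → View (Edge (k + N)) N
padView k N = record
  { view   = λ Q (u , v) → go Q (splitAt k u) (splitAt k v)
  ; splits = λ s (u , v) → go-splits s (splitAt k u) (splitAt k v)
  }
  where
  go : (Fin N → Fin N → Bool) → Fin k ⊎ Fin N → Fin k ⊎ Fin N → Bool
  go Q (inj₂ u) (inj₂ v) = Q u v
  go Q _        _        = false
  go-splits : ∀ {a b c} → (∀ u v → Splits (a u v) (b u v) (c u v)) →
              ∀ u v → Splits (go a u v) (go b u v) (go c u v)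
  go-splits s (inj₂ u) (inj₂ v) = s u v
  go-splits s (inj₂ u) (inj₁ v) = none
  go-splits s (inj₁ u) _        = none

-- The edges that touch a padding vertex. They do not depend on the ranking of the leaves.
padEdge : ∀ k N → Edge (k + N) → Bool
padEdge k N (u , v) = go (splitAt k u) (splitAt k v)
  where
  go : Fin k ⊎ Fin N → Fin k ⊎ Fin N → Bool
  go (inj₁ u) (inj₁ v) = u <F v
  go (inj₁ u) (inj₂ v) = true
  go (inj₂ u) _        = false

before-padRank : ∀ k (π : Permutation′ N) (e : Edge (k + N)) →
  Splits (before (padRank k π) (proj₁ e) (proj₂ e)) (padEdge k N e) (view (padView k N) (before π) e)
before-padRank {N} k π (u , v) with splitAt k u | splitAt k v
... | inj₁ a | inj₁ b rewrite Fin.toℕ-↑ˡ a N | Fin.toℕ-↑ˡ b N with a <F b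
...   | true  = left
...   | false = none
before-padRank {N} k π (u , v) | inj₁ a | inj₂ b
  rewrite <ᵇ-true (subst₂ _<_ (sym (Fin.toℕ-↑ˡ a N)) (sym (Fin.toℕ-↑ʳ k (π ⟨$⟩ʳ b))) (≤-trans (Fin.toℕ<n a) (m≤m+n k _))) = left
before-padRank {N} k π (u , v) | inj₂ a | inj₁ b
  rewrite <ᵇ-false (<⇒≯ (subst₂ _<_ (sym (Fin.toℕ-↑ˡ b N)) (sym (Fin.toℕ-↑ʳ k (π ⟨$⟩ʳ a))) (≤-trans (Fin.toℕ<n b) (m≤m+n k _)))) = none
before-padRank {N} k π (u , v) | inj₂ a | inj₂ b
  rewrite Fin.toℕ-↑ʳ k (π ⟨$⟩ʳ a) | Fin.toℕ-↑ʳ k (π ⟨$⟩ʳ b) | +-<ᵇ k (toℕ (π ⟨$⟩ʳ a)) (toℕ (π ⟨$⟩ʳ b))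
  with before π a b
... | true  = right
... | false = none

module Instances (k : ℕ) (ms : List ℕ) where
  leaves : ℕ
  leaves = size 1 ms
  V : View (Edge (k + leaves)) leaves
  V = padView k leaves
  L : List (Edge (k + leaves))
  L = allEdges (k + leaves)
  rank : Inputs 1 ms → Permutation′ (k + leaves)
  rank x = padRank k (rankFrom ↔-refl x)
  -- The same edges for every input: read last, they act on the memory as a fixed function, the
  -- `post` of a pass.
  fixed : List (Edge (k + leaves))
  fixed = filterᵇ (view V (λ u v → before {1} ↔-refl (ancestor ms u) (ancestor ms v))) L ++ filterᵇ (padEdge k leaves) L
  stream : Inputs 1 ms → List (Edge (k + leaves))
  stream x = layers ms V L x ++ fixed
  sink : Inputs 1 ms → Fin (k + leaves)
  sink x = k ↑ʳ follow zero x

  stream-valid : ∀ x → ValidStream (rank x) (stream x)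
  stream-valid x = ↭-sym (begin
    edgeList (rank x)
      ≡⟨ edgeList≡ (rank x) ⟩
    filterᵇ (λ (u , v) → before (rank x) u v) L
      ↭⟨ filterᵇ-splits (before-padRank k (rankFrom ↔-refl x)) L ⟩
    filterᵇ (view V (before (rankFrom ↔-refl x))) L ++ filterᵇ (padEdge k leaves) L
      ↭⟨ ++⁺ʳ _ (layers-↭ ms V L ↔-refl x) ⟩
    (layers ms V L x ++ filterᵇ (view V (λ u v → before {1} ↔-refl (ancestor ms u) (ancestor ms v))) L) ++ filterᵇ (padEdge k leaves) L
      ≡⟨ ++-assoc (layers ms V L x) _ _ ⟩
    stream x ∎)
    where
    open PermutationReasoning
  
  sink-unique : ∀ x u → IsSink (rank x) u → u ≡ sink x
  sink-unique x u isSink = Injection.injective (↔⇒↣ (rank x)) (Fin.toℕ-injective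
    (≤-antisym (s≤s⁻¹ (≤-trans (Fin.toℕ<n (rank x ⟨$⟩ʳ u)) (≤-reflexive (sym top)))) (≮⇒≥ (isSink (sink x)))))
    where
    top : IsTop (rank x) (sink x)
    top = padRank-top k (rankFrom ↔-refl x) (follow zero x) (rankFrom-top {ms = ms} ↔-refl x zero refl)

-- Amplification

-- Seeds are fixed one at a time. With the product over the earlier seeds as weight, the average
-- over `r` of the weighted sum grows by at most `a / b`, because the hypothesis holds at every `x`;
-- some seed does no worse than average.
good-seeds : ∀ {R} (L : List X) (g : Fin R → X → ℕ) a b → 0 < R →
  (∀ x → b * ∑ (allFin R) (λ r → g r x) ≤ a * R) →
  ∀ k → ∃ λ rs → b ^ k * ∑ L (λ x → ∏ k (λ c → g (rs c) x)) ≤ a ^ k * length L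
good-seeds L g a b R>0 mean zero = (λ ()) , ≤-reflexive (cong (1 *_) (sym (length≡∑ L)))
good-seeds {R = R} L g a b R>0 mean (suc k) with good-seeds L g a b R>0 mean k
... | rs , ih = proj₁ found VF.∷ rs , (begin
    b * b ^ k * ∑ L (λ x → g (proj₁ found) x * e x)    ≡⟨ r₁ b (b ^ k) _ ⟩
    b ^ k * (b * ∑ L (λ x → g (proj₁ found) x * e x))  ≤⟨ *-monoʳ-≤ (b ^ k) (proj₂ (proj₂ found)) ⟩
    b ^ k * (a * ∑ L e)                                ≡⟨ r₂ (b ^ k) a (∑ L e) ⟩
    a * (b ^ k * ∑ L e)                                ≤⟨ *-monoʳ-≤ a ih ⟩
    a * (a ^ k * length L)                             ≡⟨ *-assoc a (a ^ k) (length L) ⟨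
    a * a ^ k * length L ∎)
  where
  open ≤-Reasoning
  r₁ : ∀ b c x → b * c * x ≡ c * (b * x)
  r₁ = solve-∀
  r₂ : ∀ c a x → c * (a * x) ≡ a * (c * x)
  r₂ = solve-∀
  e : _ → ℕ
  e x = ∏ k (λ c → g (rs c) x)
  found = ∑-≤⇒∃ (allFin R) {λ r → b * ∑ L (λ x → g r x * e x)} {λ _ → a * ∑ L e}
    (subst (0 <_) (sym (length-allFin R)) R>0) (begin
      ∑ (allFin R) (λ r → b * ∑ L (λ x → g r x * e x))
        ≡⟨ trans (∑-*ˡ (allFin R) b _) (cong (b *_) (∑-swap (allFin R) L _)) ⟩
      b * ∑ L (λ x → ∑ (allFin R) (λ r → g r x * e x))
        ≡⟨ cong (b *_) (∑-cong L (λ x → ∑-*ʳ (allFin R) (λ r → g r x) (e x))) ⟩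
      b * ∑ L (λ x → ∑ (allFin R) (λ r → g r x) * e x)
        ≡⟨ ∑-*ˡ L b _ ⟨
      ∑ L (λ x → b * (∑ (allFin R) (λ r → g r x) * e x))
        ≤⟨ ∑-mono L (λ x → ≤-trans (≤-reflexive (sym (*-assoc b _ (e x)))) (*-monoˡ-≤ (e x) (mean x))) ⟩
      ∑ L (λ x → a * R * e x)
        ≡⟨ ∑-*ˡ L (a * R) e ⟩
      a * R * ∑ L e
        ≡⟨ r₃ a R (∑ L e) ⟩
      R * (a * ∑ L e)
        ≡⟨ ∑-allFin-const R _ ⟨
      ∑ (allFin R) (λ _ → a * ∑ L e) ∎)
    where
    r₃ : ∀ a R x → a * R * x ≡ R * (a * x)
    r₃ = solve-∀

length-filter-≤ : ∀ {p} {Q : Pred X p} (Q? : Decidable Q) (b : X → Bool) (L : List X) →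
  (∀ x → Q x → b x ≡ true) → length (filter Q? L) ≤ ∑ L (𝟙 ∘ b)
length-filter-≤ Q? b []      imp = z≤n
length-filter-≤ Q? b (x ∷ L) imp with Q? x
... | no _  = ≤-trans (length-filter-≤ Q? b L imp) (m≤n+m _ (𝟙 (b x)))
... | yes q rewrite imp x q = s≤s (length-filter-≤ Q? b L imp)

funToFin-cong : ∀ {k n} {f g : Fin k → Fin n} → (∀ i → f i ≡ g i) → funToFin f ≡ funToFin g
funToFin-cong {zero}  e = refl
funToFin-cong {suc k} e = cong₂ combine (e zero) (funToFin-cong (e ∘ suc))

-- Multiplied over the copies this gives 2 to the number of wrong ones.
penalty : Bool → ℕ
penalty true  = 1
penalty false = 2

-- Each copy names a single vertex, so it is wrong about `u` or about `v` and contributes a factor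
-- of at least 2.
∏-penalty : ∀ k {n} (o : Fin k → Fin n) (u v : Fin n) → u ≢ v →
  2 ^ k ≤ ∏ k (λ c → penalty (o c == u)) * ∏ k (λ c → penalty (o c == v))
∏-penalty zero    o u v u≢v = ≤-refl
∏-penalty (suc k) o u v u≢v = begin
  2 * 2 ^ k
    ≤⟨ *-mono-≤ two (∏-penalty k (o ∘ suc) u v u≢v) ⟩
  penalty (o zero == u) * penalty (o zero == v) * (∏ k _ * ∏ k _)
    ≡⟨ r (penalty (o zero == u)) (penalty (o zero == v)) _ _ ⟩
  penalty (o zero == u) * ∏ k _ * (penalty (o zero == v) * ∏ k _) ∎
  where
  open ≤-Reasoning
  r : ∀ a b c d → a * b * (c * d) ≡ a * c * (b * d)
  r = solve-∀
  two : 2 ≤ penalty (o zero == u) * penalty (o zero == v)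
  two with o zero Fin.≟ u | o zero Fin.≟ v
  ... | yes p | yes q = ⊥-elim (u≢v (trans (sym p) q))
  ... | yes p | no  _ = ≤-refl
  ... | no  _ | yes _ = ≤-refl
  ... | no  _ | no  _ = s≤s (s≤s z≤n)

-- Passes as iterated maps, and parallel copies

iter : ∀ {M : Set} → (ℕ → M → M) → ℕ → M → M
iter g zero    x = x
iter g (suc k) x = iter (g ∘ suc) k (g 0 x)

-- Bridges two recursions: `runPasses` peels off the last pass, `runAll` the first.
iter-last : ∀ {M : Set} (g : ℕ → M → M) k x → iter g (suc k) x ≡ g k (iter g k x)
iter-last g zero    x = refl
iter-last g (suc k) x = iter-last (g ∘ suc) k (g 0 x)

iter-map : ∀ {M M′ : Set} (h : M → M′) (g : ℕ → M → M) (g′ : ℕ → M′ → M′) →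
  (∀ i x → h (g i x) ≡ g′ i (h x)) → ∀ k x → h (iter g k x) ≡ iter g′ k (h x)
iter-map h g g′ e zero    x = refl
iter-map h g g′ e (suc k) x =
  trans (iter-map h (g ∘ suc) (g′ ∘ suc) (e ∘ suc) k (g 0 x)) (cong (iter (g′ ∘ suc) k) (e 0 x))

iter-cong : ∀ {M : Set} {g g′ : ℕ → M → M} → (∀ i x → g i x ≡ g′ i x) → ∀ k x → iter g k x ≡ iter g′ k x
iter-cong = iter-map id _ _

runAll≡iter : ∀ r (p : ℕ → Pass S N ms) x st → runAll r p x st ≡ iter (λ i → runPass (p i) x) r st
runAll≡iter zero    p x st = refl
runAll≡iter (suc r) p x st = runAll≡iter r (p ∘ suc) x _

module _ {n p s} (A : StreamAlg n p s) where
  -- Indices in `ℕ` let the sequence of passes be shifted by `suc`. From index `p` on the memory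
  -- stays put, a default that `runPasses≡iter` never meets.
  stepℕ : Fin (R A) → ℕ → Fin (2 ^ s) → Edge n → Fin (2 ^ s)
  stepℕ r i st e with i <? p
  ... | yes i<p = step A r (fromℕ< i<p) st e
  ... | no  _   = st

  runPasses≡iter : ∀ r σ k (k≤p : k ≤ p) st →
    runPasses A r σ k k≤p st ≡ iter (λ i st → foldl (stepℕ r i) st σ) k st
  runPasses≡iter r σ zero    k≤p st = refl
  runPasses≡iter r σ (suc k) k<p st = trans
    (trans (cong (λ z → foldl (step A r (fromℕ< k<p)) z σ) (runPasses≡iter r σ k (<⇒≤ k<p) st))
           (foldl-step σ _))
    (sym (iter-last (λ i st → foldl (stepℕ r i) st σ) k st))
    where
    foldl-step : ∀ σ st → foldl (step A r (fromℕ< k<p)) st σ ≡ foldl (stepℕ r k) st σ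
    foldl-step []      st = refl
    foldl-step (e ∷ σ) st = trans (cong (λ z → foldl (step A r (fromℕ< k<p)) z σ) eq) (foldl-step σ _)
      where
      eq : step A r (fromℕ< k<p) st e ≡ stepℕ r k st e
      eq with k <? p
      ... | yes _ = refl
      ... | no ¬p = ⊥-elim (¬p k<p)

  -- Running the copies of the algorithm with seeds rs 0, …, rs (k - 1) in parallel.
  module Parallel {k} (rs : Fin k → Fin (R A)) where
    States = (2 ^ s) ^ k
    act : ℕ → List (Edge n) → Fin States → Fin States
    act i σ st = funToFin (λ c → foldl (stepℕ (rs c) i) (finToFun st c) σ)

    act-++ : ∀ i σ τ st → act i (σ ++ τ) st ≡ act i τ (act i σ st)
    act-++ i σ τ st = funToFin-cong (λ c → trans (foldl-++ (stepℕ (rs c) i) (finToFun st c) σ τ)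
      (cong (λ z → foldl (stepℕ (rs c) i) z τ) (sym (Fin.finToFun-funToFin _ c))))

    act-[] : ∀ i st → act i [] st ≡ st
    act-[] i st = Fin.funToFin-finToFin {k} st

    start : Fin States
    start = funToFin (init A ∘ rs)

    outputs : Fin States → Fin k → Fin n
    outputs st c = output A (rs c) (finToFun st c)

    run≡ : ∀ σ c → run A (rs c) σ ≡ outputs (iter (λ i → act i σ) p start) c
    run≡ σ c = cong (output A (rs c)) (trans (runPasses≡iter (rs c) σ p ≤-refl (init A (rs c)))
      (sym (trans (iter-map (λ st → finToFun st c) (λ i → act i σ) (λ i st → foldl (stepℕ (rs c) i) st σ)
                    (λ i st → Fin.finToFun-funToFin _ c) p start)
                  (cong (iter _ p) (Fin.finToFun-funToFin (init A ∘ rs) c)))))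

    transOf : ∀ ms {N} → ℕ → View (Edge n) (size N ms) → List (Edge n) → Trans States N ms
    transOf []       i V L = tt
    transOf (m ∷ ms) i V L = (λ f → act i (layer ms V L f)) , transOf ms i V L

    runTrans-transOf : ∀ ms {N} i (V : View (Edge n) (size N ms)) L (x : Inputs N ms) st →
      runTrans (transOf ms i V L) x st ≡ act i (layers ms V L x) st
    runTrans-transOf []       i V L x       st = sym (act-[] i st)
    runTrans-transOf (m ∷ ms) i V L (f , x) st =
      trans (cong (act i (layer ms V L f)) (runTrans-transOf ms i V L x st))
            (sym (act-++ i (layers ms V L x) (layer ms V L f) st))

-- A penalty is 2 minus the indicator of success, and success has probability at least `2 / 3`, so
-- the mean is at most `4 / 3`.
penalty-mean : ∀ {n p s} (A : StreamAlg n p s) → Solves A → ∀ ρ σ (u : Fin n) → ValidStream ρ σ →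
  (∀ v → IsSink ρ v → v ≡ u) →
  3 * ∑ (allFin (R A)) (λ r → penalty (run A r σ == u)) ≤ 4 * R A
penalty-mean A solves ρ σ u valid unique = +-cancelʳ-≤ (2 * R A) _ _ (begin
  3 * ∑ (allFin (R A)) g + 2 * R A
    ≤⟨ +-monoʳ-≤ (3 * ∑ (allFin (R A)) g) (≤-trans (solves ρ σ valid) (*-monoʳ-≤ 3 good)) ⟩
  3 * ∑ (allFin (R A)) g + 3 * ∑ (allFin (R A)) (λ r → 𝟙 (run A r σ == u))
    ≡⟨ trans (sym (*-distribˡ-+ 3 (∑ (allFin (R A)) g) _)) (cong (3 *_) (sym (∑-+ (allFin (R A)) g _))) ⟩
  3 * ∑ (allFin (R A)) (λ r → g r + 𝟙 (run A r σ == u))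
    ≡⟨ cong (3 *_) (trans (∑-cong (allFin (R A)) (λ r → two (run A r σ == u))) (∑-allFin-const (R A) 2)) ⟩
  3 * (R A * 2)
    ≡⟨ r₁ (R A) ⟩
  4 * R A + 2 * R A ∎)
  where
  open ≤-Reasoning
  g : Fin (R A) → ℕ
  g r = penalty (run A r σ == u)
  r₁ : ∀ a → 3 * (a * 2) ≡ 4 * a + 2 * a
  r₁ = solve-∀
  two : ∀ b → penalty b + 𝟙 b ≡ 2
  two true  = refl
  two false = refl
  good : goodSeeds A ρ σ ≤ ∑ (allFin (R A)) (λ r → 𝟙 (run A r σ == u))
  good = length-filter-≤ (λ r → isSink? ρ (run A r σ)) (λ r → run A r σ == u) (allFin (R A))
    (λ r isSink → subst (λ z → (z == u) ≡ true) (sym (unique _ isSink)) (==-refl u))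

-- The initial rectangle of all inputs

full : ∀ ms {N} → Rect N ms
full []           = tt
full (m ∷ ms) {N} = allVecs m N , full ms

∈-allVecs : ∀ {m N} (x : Vec (Fin m) N) → x ∈ allVecs m N
∈-allVecs []      = here refl
∈-allVecs (y ∷ x) = ∈-cartesianProductWith⁺ _∷_ (∈-allFin y) (∈-allVecs x)

allVecs-dense : ∀ m N → 0 < m → DenseSet 1 (allVecs m N)
allVecs-dense m N m>0 = denseSet (λ h → ≤-refl)
  (subst (0 <_) (sym (length-allVecs m N)) (m^n>0 m {{>-nonZero m>0}} N))
  (≤-reflexive (trans (sym (length-allVecs m N)) (sym (*-identityˡ _))))

-- With one coordinate there are `m` vectors and every value has a nonempty fibre, so no value is
-- light.
allVecs-balanced : ∀ m → 0 < m → Balanced (allVecs m 1) zero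
allVecs-balanced m m>0 = subst (_< m) (sym no-light) m>0
  where
  not-light : ∀ y → light (allVecs m 1) zero y ≡ false
  not-light y = <ᵇ-false (λ lt → <⇒≱ lt (begin
    length (allVecs m 1)
      ≡⟨ trans (length-allVecs m 1) (*-identityʳ m) ⟩
    m
      ≤⟨ m≤n*m m 8 ⟩
    8 * m
      ≡⟨ *-identityʳ (8 * m) ⟨
    8 * m * 1
      ≡⟨ cong (λ b → 8 * m * 𝟙 b) (==-refl y) ⟨
    8 * m * 𝟙 (y == y)
      ≤⟨ *-monoʳ-≤ (8 * m) (∈-≤-∑ (∈-allVecs (y ∷ [])) (λ x → 𝟙 (lookup x zero == y))) ⟩
    8 * m * ∑ (allVecs m 1) (λ x → 𝟙 (lookup x zero == y))
      ≡⟨ cong (8 * m *_) (length-filterᵇ (λ x → lookup x zero == y) (allVecs m 1)) ⟨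
    8 * m * length (fibre (allVecs m 1) zero y) ∎))
    where open ≤-Reasoning
  no-light : 2 * count (light (allVecs m 1) zero) ≡ 0
  no-light = cong (2 *_) (trans (∑-cong (allFin m) (cong 𝟙 ∘ not-light)) (trans (∑-allFin-const m 0) (*-zeroʳ m)))

-- Choice of the parameters

tailArities : ℕ → ℕ → List ℕ
tailArities t zero    = 2 ∷ []
tailArities t (suc r) = t ∷ tailArities t r

length-tailArities : ∀ t r → length (tailArities t r) ≡ suc r
length-tailArities t zero    = refl
length-tailArities t (suc r) = cong suc (length-tailArities t r)

size-tailArities : ∀ t r N → size N (tailArities t r) ≡ N * t ^ r * 2
size-tailArities t zero    N = cong (_* 2) (sym (*-identityʳ N))
size-tailArities t (suc r) N = trans (size-tailArities t r (N * t)) (cong (_* 2) (*-assoc N t (t ^ r)))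

bushy-tailArities : ∀ q t r → 32 * q ≤ t → Bushy q t (tailArities t r)
bushy-tailArities q t zero    le = le , refl
bushy-tailArities q t (suc r) le = le , bushy-tailArities q t r le

full-dense : ∀ t r {N} → 0 < t → Dense 1 (full (tailArities t r) {N})
full-dense t zero    {N} t>0 = allVecs-dense 2 N (s≤s z≤n) , tt
full-dense t (suc r) {N} t>0 = allVecs-dense t N t>0 , full-dense t r t>0

-- Reduces to (9/8) ^ 60 > 2 ^ 10.
too-many-copies : ∀ p → 0 < p →
  64 ^ p * (16 * 4 ^ (60 * p + 60 * p)) < 3 ^ (60 * p + 60 * p) * 2 ^ (60 * p)
too-many-copies p p>0 = begin-strict
  64 ^ p * (16 * 4 ^ (h + h))
    ≤⟨ *-monoʳ-≤ (64 ^ p) (*-monoˡ-≤ (4 ^ (h + h)) 16≤16^p) ⟩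
  64 ^ p * (16 ^ p * 4 ^ (h + h))
    ≡⟨ cong (λ z → 64 ^ p * (16 ^ p * z)) (square 4 p) ⟩
  64 ^ p * (16 ^ p * (16 ^ 60) ^ p)
    ≡⟨ trans (cong (64 ^ p *_) (sym (^-distribʳ-* p 16 (16 ^ 60)))) (sym (^-distribʳ-* p 64 (16 * 16 ^ 60))) ⟩
  (64 * (16 * 16 ^ 60)) ^ p
    <⟨ ^-monoˡ-< p {{>-nonZero p>0}} (<ᵇ⇒< (64 * (16 * 16 ^ 60)) (9 ^ 60 * 2 ^ 60) _) ⟩
  (9 ^ 60 * 2 ^ 60) ^ p
    ≡⟨ ^-distribʳ-* p (9 ^ 60) (2 ^ 60) ⟩
  (9 ^ 60) ^ p * (2 ^ 60) ^ p
    ≡⟨ cong₂ _*_ (sym (square 3 p)) (^-*-assoc 2 60 p) ⟩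
  3 ^ (h + h) * 2 ^ h ∎
  where
  open ≤-Reasoning
  h = 60 * p
  16≤16^p : 16 ≤ 16 ^ p
  16≤16^p = ^-monoʳ-≤ 16 p>0
  square : ∀ a p → a ^ (60 * p + 60 * p) ≡ ((a * a) ^ 60) ^ p
  square a p = trans (^-distribˡ-+-* a (60 * p) (60 * p))
    (trans (sym (^-distribʳ-* (60 * p) a a)) (sym (^-*-assoc (a * a) 60 p)))

square-root : ∀ h a b → 2 ^ (h + h) ≤ a * b → 2 ^ h ≤ a ⊎ 2 ^ h ≤ b
square-root h a b le with 2 ^ h ≤? a | 2 ^ h ≤? b
... | yes p | _     = inj₁ p
... | no _  | yes q = inj₂ q
... | no ¬p | no ¬q = ⊥-elim (<⇒≱ (*-mono-< (≰⇒> ¬p) (≰⇒> ¬q))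
                        (≤-trans (≤-reflexive (sym (^-distribˡ-+-* 2 h h))) le))

-- One pass shrinks a level by a factor of at most 2p · 2 ^ (120ps) ≤ 2 ^ (121ps).
budget : ℕ → ℕ → ℕ
budget p s = 121 * (p * p) * s

arity : ℕ → ℕ → ℕ
arity p s = 32 * budget p s

2*n≤2^n : ∀ n → 2 * suc n ≤ 2 ^ suc n
2*n≤2^n zero    = ≤-refl
2*n≤2^n (suc n) = begin
  2 * suc (suc n)         ≡⟨ *-suc 2 (suc n) ⟩
  2 + 2 * suc n           ≤⟨ +-mono-≤ (^-monoʳ-≤ 2 {1} {suc n} (s≤s z≤n)) (2*n≤2^n n) ⟩
  2 ^ suc n + 2 ^ suc n   ≡⟨ cong (2 ^ suc n +_) (+-identityʳ _) ⟨
  2 * 2 ^ suc n ∎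
  where open ≤-Reasoning

-- Since `2 * p ≤ 2 ^ (s * p)`, one pass costs at most `2 ^ (121 * p * s)` and all of them at most
-- `2 ^ budget p s`. Passing to base 8 makes the inequality strict.
memory-bound : ∀ p s → 0 < p → 0 < s →
  (2 * p * (2 ^ s) ^ (60 * p + 60 * p)) ^ p < 8 ^ budget p s
memory-bound p@(suc p′) s p>0 s>0 = begin-strict
  (2 * p * (2 ^ s) ^ (60 * p + 60 * p)) ^ p
    ≡⟨ cong (λ z → (2 * p * z) ^ p) (^-*-assoc 2 s (60 * p + 60 * p)) ⟩
  (2 * p * 2 ^ (s * (60 * p + 60 * p))) ^ p
    ≤⟨ ^-monoˡ-≤ p (*-monoˡ-≤ (2 ^ (s * (60 * p + 60 * p)))
         (≤-trans (2*n≤2^n p′) (^-monoʳ-≤ 2 (≤-trans (≤-reflexive (sym (*-identityˡ p))) (*-monoˡ-≤ p s>0))))) ⟩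
  (2 ^ (s * p) * 2 ^ (s * (60 * p + 60 * p))) ^ p
    ≡⟨ cong (_^ p) (sym (^-distribˡ-+-* 2 (s * p) _)) ⟩
  (2 ^ (s * p + s * (60 * p + 60 * p))) ^ p
    ≡⟨ ^-*-assoc 2 (s * p + s * (60 * p + 60 * p)) p ⟩
  2 ^ ((s * p + s * (60 * p + 60 * p)) * p)
    ≡⟨ cong (2 ^_) (r s p) ⟩
  2 ^ budget p s
    <⟨ ^-monoˡ-< (budget p s) {{>-nonZero d>0}} (s≤s (s≤s (s≤s z≤n))) ⟩
  8 ^ budget p s ∎
  where
  open ≤-Reasoning
  d>0 : 0 < budget p s
  d>0 = *-mono-≤ {1} {121 * (p * p)} (*-mono-≤ {1} {121} (s≤s z≤n) (*-mono-≤ p>0 p>0)) s>0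
  r : ∀ s p → (s * p + s * (60 * p + 60 * p)) * p ≡ 121 * (p * p) * s
  r = solve-∀

no-small-algorithm : ∀ k r s → 0 < s →
  (A : StreamAlg (k + size 1 (arity (suc r) s ∷ tailArities (arity (suc r) s) r)) (suc r) s) →
  Solves A → ⊥
no-small-algorithm k r s s>0 A solves = <⇒≱ (too-many-copies p z<s)
  (subst (λ z → 3 ^ K * 2 ^ h ≤ 64 ^ z * (16 * 4 ^ K)) (length-tailArities t r) conclusion)
  where
  p = suc r
  q = budget p s
  t = arity p s
  -- The list has `p` entries, `r` times `t` and a final 2: one level below the root layer for each
  -- pass.
  ars = tailArities t r
  -- For two distinct leaves, `h` of the `K` copies, that is half, are wrong about one of them.
  h = 60 * p
  K = h + h
  t>0 : 0 < t
  t>0 = *-mono-≤ {1} {32} (s≤s z≤n)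
          (*-mono-≤ {1} {121 * (p * p)} (*-mono-≤ {1} {121} (s≤s z≤n) (*-mono-≤ {1} {p} z<s (z<s {r}))) s>0)
  open Instances k (t ∷ ars)
  inputs = points (full (t ∷ ars) {1})
  g : Fin (R A) → Inputs 1 (t ∷ ars) → ℕ
  g r x = penalty (run A r (stream x) == sink x)
  seeds : ∃ λ rs → 3 ^ K * ∑ inputs (λ x → ∏ K (λ c → g (rs c) x)) ≤ 4 ^ K * length inputs
  seeds = good-seeds inputs g 4 3 (R≥1 A)
    (λ x → penalty-mean A solves (rank x) (stream x) (sink x) (stream-valid x) (sink-unique x)) K
  rs = proj₁ seeds
  open Parallel A rs
  passes : ℕ → Pass States 1 (t ∷ ars)
  passes i = mkPass (transOf (t ∷ ars) i V L) (act i fixed)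
  -- The weight of an input depends only on the final memory and the leaf reached, as `adversary`
  -- requires.
  W : Fin States → Fin leaves → ℕ
  W st u = ∏ K (λ c → penalty (outputs st c == k ↑ʳ u))
  e : Inputs 1 (t ∷ ars) → ℕ
  e x = W (runAll (length ars) passes x start) (follow {ms = t ∷ ars} zero x)
  final : ∀ x → runAll (length ars) passes x start ≡ iter (λ i → act i (stream x)) p start
  final x = trans (cong (λ z → runAll z passes x start) (length-tailArities t r))
    (trans (runAll≡iter p passes x start)
      (iter-cong (λ i st → trans (cong (act i fixed) (runTrans-transOf (t ∷ ars) i V L x st))
                                 (sym (act-++ i (layers (t ∷ ars) V L x) fixed st))) p start))
  e≡ : ∀ x → e x ≡ ∏ K (λ c → g (rs c) x)
  e≡ x = trans (cong (λ z → W z (follow {ms = t ∷ ars} zero x)) (final x))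
    (∏-cong K (λ c → cong (λ z → penalty (z == sink x)) (sym (run≡ (stream x) c))))
    where
    ∏-cong : ∀ N {f g : Fin N → ℕ} → (∀ i → f i ≡ g i) → ∏ N f ≡ ∏ N g
    ∏-cong N eq = ≤-antisym (∏-mono N (≤-reflexive ∘ eq)) (∏-mono N (≤-reflexive ∘ sym ∘ eq))
  States>0 : 0 < States
  States>0 = m^n>0 (2 ^ s) {{m^n≢0 2 s}} K
  conclusion : 3 ^ K * 2 ^ h ≤ 64 ^ length ars * (16 * 4 ^ K)
  -- Here `c = p`, the number of layers below the root layer, and `Q = 2 * p * States`. The sets
  -- start as whole cubes, so `P = 1`, and the initial mean is at most `4 ^ K / 3 ^ K`.
  conclusion = adversary t ars {q = q} {c = p} passes (allVecs t 1) (full ars) zero start W (2 ^ h) (4 ^ K) (3 ^ K) e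
    (bushy-tailArities q t r ≤-refl) States>0 z<s (≤-reflexive (length-tailArities t r)) ≤-refl
    (subst (_< 8 ^ q) (sym (trans (*-identityˡ _) (cong ((2 * p * States) ^_) (length-tailArities t r)))) (memory-bound p s z<s s>0))
    (nonempty (allVecs-dense t 1 t>0)) (allVecs-balanced t t>0) (full-dense t r t>0) (m^n>0 4 K)
    (≤-trans (≤-reflexive (cong (3 ^ K *_) (∑-cong inputs e≡))) (proj₂ seeds))
    (λ _ → refl)
    (λ st u u′ u≢u′ → square-root h (W st u) (W st u′)
      (∏-penalty K (outputs st) (k ↑ʳ u) (k ↑ʳ u′) (u≢u′ ∘ Fin.↑ʳ-injective k u u′)))

-- With `2 * arity p s ^ p` vertices or more the leaves of the hard tree fit, and the other vertices
-- become padding.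
vertex-bound : ∀ n p s → 0 < p → 0 < s → (A : StreamAlg n p s) → Solves A → n < 2 * arity p s ^ p
vertex-bound n (suc r) s p>0 s>0 A solves = ≰⇒> λ le →
  no-small-algorithm (n ∸ leaves) r s s>0
    (subst (λ n → StreamAlg n (suc r) s) (n≡ le) A)
    (transport (n≡ le) A solves)
  where
  t = arity (suc r) s
  leaves = size 1 (t ∷ tailArities t r)
  leaves≡ : leaves ≡ 2 * t ^ suc r
  leaves≡ = trans (size-tailArities t r (1 * t))
    (trans (*-comm (1 * t * t ^ r) 2) (cong (λ z → 2 * (z * t ^ r)) (*-identityˡ t)))
  n≡ : 2 * t ^ suc r ≤ n → n ≡ n ∸ leaves + leaves
  n≡ le = sym (m∸n+n≡m (≤-trans (≤-reflexive leaves≡) le))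
  transport : ∀ {n′} (eq : n ≡ n′) (A : StreamAlg n (suc r) s) → Solves A →
    Solves (subst (λ n → StreamAlg n (suc r) s) eq A)
  transport refl A solves = solves

-- Without memory the passes are idle, so one pass with one bit is as good.
one-pass : ∀ {n p} → StreamAlg n p 0 → StreamAlg n 1 1
one-pass A = record
  { R = R A ; R≥1 = R≥1 A ; init = λ _ → zero ; step = λ _ _ st _ → st ; output = λ r _ → output A r zero }

one-pass-solves : ∀ {n p} (A : StreamAlg n p 0) → Solves A → Solves (one-pass A)
one-pass-solves {n} A solves ρ σ valid =
  subst (λ z → 2 * R A ≤ 3 * z) (same (allFin (R A))) (solves ρ σ valid)
  where
  run≡ : ∀ r → run A r σ ≡ run (one-pass A) r σ
  run≡ r = cong (output A r) (Fin1-unique _)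
    where
    Fin1-unique : (i : Fin 1) → i ≡ zero
    Fin1-unique zero = refl
  same : ∀ L → length (filter (λ r → isSink? ρ (run A r σ)) L) ≡
               length (filter (λ r → isSink? ρ (run (one-pass A) r σ)) L)
  same []      = refl
  same (r ∷ L) rewrite run≡ r with does (isSink? ρ (run (one-pass A) r σ))
  ... | true  = cong suc (same L)
  ... | false = same L

theorem4p3 : Σ ℕ λ a → Σ ℕ λ b → Σ ℕ λ N →
    (1 ≤ a) × (1 ≤ b) ×
    (∀ n p s → N ≤ n → 1 ≤ p → (A : StreamAlg n p s) → Solves A →
    a ^ p * n ≤ (b * (p * p) * s) ^ p)
-- Here `7744 = 2 * 32 * 121`. As a threshold it is `2 * arity 1 1`, the vertex bound for
-- `one-pass`, which rules out `s = 0`.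
theorem4p3 = 1 , 7744 , 7744 , s≤s z≤n , s≤s z≤n , bound
  where
  bound : ∀ n p s → 7744 ≤ n → 1 ≤ p → (A : StreamAlg n p s) → Solves A →
          1 ^ p * n ≤ (7744 * (p * p) * s) ^ p
  bound n p zero    N≤n p>0 A solves =
    ⊥-elim (<⇒≱ (vertex-bound n 1 1 (s≤s z≤n) (s≤s z≤n) (one-pass A) (one-pass-solves A solves)) N≤n)
  bound n p s@(suc _) N≤n p>0 A solves = begin
    1 ^ p * n                       ≡⟨ trans (cong (_* n) (^-zeroˡ p)) (*-identityˡ n) ⟩
    n                               ≤⟨ <⇒≤ (vertex-bound n p s p>0 z<s A solves) ⟩
    -- The factor 2 of the binary level moves under the power by `2 ≤ 2 ^ p`.
    2 * arity p s ^ p               ≤⟨ *-monoˡ-≤ (arity p s ^ p) (^-monoʳ-≤ 2 p>0) ⟩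
    2 ^ p * arity p s ^ p           ≡⟨ ^-distribʳ-* p 2 (arity p s) ⟨
    (2 * arity p s) ^ p             ≡⟨ cong (_^ p) (trans (sym (*-assoc 2 32 (budget p s)))
                                         (trans (sym (*-assoc 64 (121 * (p * p)) s))
                                                (cong (_* s) (sym (*-assoc 64 121 (p * p)))))) ⟩
    (7744 * (p * p) * s) ^ p ∎
    where open ≤-Reasoning
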